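{- For every integer $\ell\ge1$, every instance, and every output $\pi$ of the capacity-scaling algorithm, $$\frac{2^{\ell+2}}{2^{\ell}-1}\, p\bigl(\textsc{Alg}(B+(4\ell-1)\chi)\bigr)\ \ge\ p(\textsc{Opt}(B))\quad\text{for all } B\in\mathbb{R}_{\ge0},$$ i.e., the capacity-scaling algorithm is $\bigl((4\ell-1)\chi,\frac{2^{\ell+2}}{2^\ell-1}\bigr)$-competitive.
   Context: An instance consists of a finite undirected graph $G=(V,E)$, edge costs $c(e)>0$, vertex prizes $p(v)\ge0$ and a root $r\in V$. For a subgraph $G'=(V',E')$, $p(G')=\sum_{v\in V'}p(v)$, $c(G')=\sum_{e\in E'}c(e)$. A rooted subtree is a subtree of $G$ containing $r$; $\mathcal T$ is the set of rooted subtrees. For $B\ge0$, $\textsc{Opt}(B)$ is a rooted subtree maximizing $p(T)$ subject to $c(T)\le B$. Let $V^*=\{v:p(v)>0\}$. An incremental solution is a sequence $\pi=(e_1,\dots,e_l)$ of distinct edges such that every prefix, together with $r$, forms a rooted subtree and the whole sequence spans $V^*$; $\textsc{Alg}(B)$ is the rooted subtree formed by $r$ and the edges $e_i$ of the output with $\sum_{j\le i}c(e_j)\le B$. An algorithm is $(\alpha,\mu)$-competitive if for every instance $\mu\,p(\textsc{Alg}(B+\alpha))\ge p(\textsc{Opt}(B))$ for all $B\ge 0$. Root eccentricity: $\chi=\max_v\ell(v)$ with $\ell(v)$ the minimum cost of an $r$-$v$ path. Density-greedy algorithm for trees (input: a tree $H$ with root $r$): for a rooted subtree $T$ with at least one edge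 let $d(T)=p(T)/c(T)$ (trivial tree: density 0); a min-max subtree is an inclusion-minimal rooted subtree of maximum density; for a rooted subtree $\overline T$, $H/\overline T$ is obtained by contracting $\overline T$ into $r$ (root prize set to $0$, other prizes and costs unchanged). Start with $\pi=()$, $\overline T=(\{r\},\emptyset)$; while $H/\overline T$ has nonzero total prize, choose any min-max subtree $T^*$ of $H/\overline T$, append to $\pi$ the edge of $H$ corresponding to the unique edge of $T^*$ incident to $r$, and add it to $\overline T$; output $\pi$. Capacity-scaling algorithm: $i=0$, $\pi=()$; while $\pi$ does not span all vertices of $V^*$: let $T_i\in\arg\max\{p(T):T\in\mathcal T, c(T)\le 2^i\chi\}$ (arbitrary maximizer), run the density-greedy algorithm for trees on $T_i$ with root $r$ to obtain $\pi_i$, append $\pi_i$ to $\pi$ while skipping edges already in $\pi$, edges parallel to edges already in $\pi$, and edges that would close a cycle with the edges already in $\pi$; set $i=i+1$. Output $\pi$. -}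

module Defs where

open import Data.Nat as ℕ using (ℕ; zero; suc; _^_; _∸_)
open import Data.Fin using (Fin; zero; suc; _≟_)
open import Data.Bool using (Bool; true; false; _∧_; _∨_; not; if_then_else_)
open import Data.List using (List; []; _∷_; _++_; [_]; take; length)
import Data.List as List
open import Data.List.Relation.Unary.All using (All)
open import Data.Bool.ListAction using (any)
open import Data.List.Membership.Propositional using (_∈_)
open import Data.List.Relation.Unary.Unique.Propositional using (Unique)
open import Data.Product using (Σ; Σ-syntax; ∃; ∃-syntax; _×_; _,_)
open import Data.Sum using (_⊎_)
open import Relation.Nullary using (¬_; yes; no)
open import Relation.Nullary.Decidable using (⌊_⌋)
open import Relation.Binary using (Rel; Decidable; IsTotalOrder)
open import Relation.Binary.PropositionalEquality using (_≡_; _≢_)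
open import Algebra.Structures using (IsCommutativeRing)

-- Ordered fields (the paper works over ℝ).
-- Equality is propositional; the order is total and (classically) decidable.

record OrderedField : Set₁ where
  infixl 6 _+_
  infixl 7 _*_
  infix 4 _≤_
  field
    Carrier : Set
    _+_ _*_ : Carrier → Carrier → Carrier
    -_      : Carrier → Carrier
    0# 1#   : Carrier
    _⁻¹     : Carrier → Carrier
    _≤_     : Rel Carrier _
    isCommutativeRing : IsCommutativeRing _≡_ _+_ _*_ -_ 0# 1#
    0≢1       : 0# ≢ 1#
    ⁻¹-inverse : ∀ x → x ≢ 0# → x * (x ⁻¹) ≡ 1#
    isTotalOrder : IsTotalOrder _≡_ _≤_
    _≤?_    : Decidable _≤_
    +-mono-≤ : ∀ {x y} z → x ≤ y → x + z ≤ y + z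
    *-nonneg : ∀ {x y} → 0# ≤ x → 0# ≤ y → 0# ≤ x * y

  infix 4 _<_
  _<_ : Carrier → Carrier → Set
  x < y = x ≤ y × x ≢ y

  ℕ→F : ℕ → Carrier
  ℕ→F zero    = 0#
  ℕ→F (suc k) = 1# + ℕ→F k

  sumF : ∀ {k} → (Fin k → Carrier) → Carrier
  sumF {zero}  f = 0#
  sumF {suc k} f = f zero + sumF (λ i → f (suc i))

anyF : ∀ {k} → (Fin k → Bool) → Bool
anyF {zero}  f = false
anyF {suc k} f = f zero ∨ anyF (λ i → f (suc i))

module Theory (F : OrderedField) where
  open OrderedField F public

  -- An instance: undirected multigraph with vertex set Fin n, edges Fin m
  -- (edge e has endpoints src e, tgt e), positive edge costs,
  -- nonnegative prizes and a root.
  record Instance (n m : ℕ) : Set where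
    field
      src tgt   : Fin m → Fin n
      cost      : Fin m → Carrier
      cost-pos  : ∀ e → 0# < cost e
      prize     : Fin n → Carrier
      prize-nonneg : ∀ v → 0# ≤ prize v
      root      : Fin n

  module Inst {n m : ℕ} (I : Instance n m) where
    open Instance I public

    Edge : Set
    Edge = Fin m

    ESet : Set
    ESet = Edge → Bool

    _∪_ : ESet → ESet → ESet
    (S ∪ T) e = S e ∨ T e

    _without_ : ESet → Edge → ESet
    (S without e) e' = S e' ∧ not ⌊ e ≟ e' ⌋

    toSet : List Edge → ESet
    toSet L e = any (λ e' → ⌊ e' ≟ e ⌋) L

    inV : ESet → Fin n → Bool
    inV S v = ⌊ v ≟ root ⌋ ∨ anyF (λ e → S e ∧ (⌊ src e ≟ v ⌋ ∨ ⌊ tgt e ≟ v ⌋))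

    costS : ESet → Carrier
    costS S = sumF (λ e → if S e then cost e else 0#)

    prizeS : ESet → Carrier
    prizeS S = sumF (λ v → if inV S v then prize v else 0#)

    data Walk : Fin n → Fin n → List Edge → Set where
      []  : ∀ {v} → Walk v v []
      fwd : ∀ {u v e w} → src e ≡ u → Walk (tgt e) v w → Walk u v (e ∷ w)
      bwd : ∀ {u v e w} → tgt e ≡ u → Walk (src e) v w → Walk u v (e ∷ w)

    walkCost : List Edge → Carrier
    walkCost = List.foldr (λ e c → cost e + c) 0#

    Reach : ESet → Fin n → Fin n → Set
    Reach S u v = Σ[ w ∈ List Edge ] (Walk u v w × All (λ e → S e ≡ true) w)

    -- (r, S) is a rooted subtree: connected and acyclic
    -- (acyclic: no edge of S lies on a cycle, i.e. each edge is a bridge)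
    Connected : ESet → Set
    Connected S = ∀ v → inV S v ≡ true → Reach S root v

    Acyclic : ESet → Set
    Acyclic S = ∀ e → S e ≡ true → ¬ Reach (S without e) (src e) (tgt e)

    RootedSubtree : ESet → Set
    RootedSubtree S = Connected S × Acyclic S

    IsDist : Fin n → Carrier → Set
    IsDist v d = (Σ[ w ∈ List Edge ] (Walk root v w × walkCost w ≡ d))
               × (∀ w → Walk root v w → d ≤ walkCost w)

    IsEccentricity : Carrier → Set
    IsEccentricity χ = (∀ v → Σ[ d ∈ Carrier ] (IsDist v d × d ≤ χ))
                     × (Σ[ v ∈ Fin n ] IsDist v χ)

    algEdges : Carrier → List Edge → List Edge
    algEdges B = go 0#
      where
      go : Carrier → List Edge → List Edge
      go acc [] = []
      go acc (e ∷ es) with (acc + cost e) ≤? B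
      ... | yes _ = e ∷ go (acc + cost e) es
      ... | no  _ = go (acc + cost e) es

    Alg : Carrier → List Edge → ESet
    Alg B π = toSet (algEdges B π)

    -- Density-greedy algorithm on a tree H (edge set of a rooted subtree).
    -- H/T̄ (T̄ ⊆ H a rooted subtree): its rooted subtrees are the edge sets
    -- S ⊆ H ∖ T̄ such that T̄ ∪ S is a rooted subtree; its vertices other
    -- than the contracted root are those outside V(T̄), the root prize is 0.

    _⊆_ : ESet → ESet → Set
    S ⊆ T = ∀ e → S e ≡ true → T e ≡ true

    ContrSubtree : ESet → ESet → ESet → Set
    ContrSubtree H Tb S = S ⊆ H × (∀ e → S e ≡ true → Tb e ≡ false)
                          × RootedSubtree (Tb ∪ S)

    contrPrize : ESet → ESet → Carrier
    contrPrize Tb S = sumF (λ v → if inV S v ∧ not (inV Tb v) then prize v else 0#)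

    residual : ESet → ESet → Carrier
    residual H Tb = contrPrize Tb H

    density : ESet → ESet → Carrier
    density Tb S = if anyF S then contrPrize Tb S * (costS S) ⁻¹ else 0#

    MaxDensity : ESet → ESet → ESet → Set
    MaxDensity H Tb S = ContrSubtree H Tb S
                      × (∀ S' → ContrSubtree H Tb S' → density Tb S' ≤ density Tb S)

    MinMax : ESet → ESet → ESet → Set
    MinMax H Tb S = MaxDensity H Tb S
                  × (∀ S' → MaxDensity H Tb S' → S' ⊆ S → ∀ e → S' e ≡ S e)

    -- edge incident to (a vertex of) the contracted root r = V(T̄)
    IncidentTo : ESet → Edge → Set
    IncidentTo Tb e = inV Tb (src e) ≡ true ⊎ inV Tb (tgt e) ≡ true

    -- GreedyFrom H T̄ rest : "rest" is a possible continuation of the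
    -- output when the already chosen edges are T̄ (a list, in order)
    data GreedyFrom (H : ESet) : List Edge → List Edge → Set where
      finish : ∀ {Tb} → residual H (toSet Tb) ≡ 0# → GreedyFrom H Tb []
      next   : ∀ {Tb e rest} → residual H (toSet Tb) ≢ 0#
             → (S : ESet) → MinMax H (toSet Tb) S → S e ≡ true
             → IncidentTo (toSet Tb) e
             → GreedyFrom H (Tb ++ [ e ]) rest
             → GreedyFrom H Tb (e ∷ rest)

    DensityGreedy : ESet → List Edge → Set
    DensityGreedy H π = GreedyFrom H [] π

    Parallel : Edge → Edge → Set
    Parallel e e' = (src e ≡ src e' × tgt e ≡ tgt e') ⊎ (src e ≡ tgt e' × tgt e ≡ src e')

    Skip : List Edge → Edge → Set
    Skip π e = e ∈ π
             ⊎ (Σ[ e' ∈ Edge ] (e' ∈ π × Parallel e e'))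
             ⊎ Reach (toSet π) (src e) (tgt e)   -- e would close a cycle

    data Merge : List Edge → List Edge → List Edge → Set where
      done : ∀ {π} → Merge π [] π
      skip : ∀ {π e es π'} → Skip π e → Merge π es π' → Merge π (e ∷ es) π'
      keep : ∀ {π e es π'} → ¬ Skip π e → Merge (π ++ [ e ]) es π' → Merge π (e ∷ es) π'

    Spans : List Edge → Set
    Spans π = ∀ v → 0# < prize v → inV (toSet π) v ≡ true

    IsBudgetMax : Carrier → ℕ → ESet → Set
    IsBudgetMax χ i T = RootedSubtree T × costS T ≤ ℕ→F (2 ^ i) * χ
                      × (∀ T' → RootedSubtree T' → costS T' ≤ ℕ→F (2 ^ i) * χ
                                → prizeS T' ≤ prizeS T)

    -- CS χ i π out : starting phase i with current output π, the algorithm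
    -- may terminate with output out
    data CS (χ : Carrier) : ℕ → List Edge → List Edge → Set where
      stop : ∀ {i π} → Spans π → CS χ i π π
      step : ∀ {i π πᵢ π' out} → ¬ Spans π
           → (T : ESet) → IsBudgetMax χ i T
           → DensityGreedy T πᵢ
           → Merge π πᵢ π'
           → CS χ (suc i) π' out
           → CS χ i π out

    CapacityScalingOutput : Carrier → List Edge → Set
    CapacityScalingOutput χ π = CS χ 0 [] π

{-# OPTIONS --safe #-}
module Submission where

-- Only completed phases matter, and of the density-greedy runs only that each
-- spans all prizes of its tree Tᵢ.  Let i be the last phase completed within the
-- budget; since the phases cost a geometric sum, B + 4ℓχ < 4 · 2^i χ.  It
-- therefore suffices that every tree T of cost at most B contains at most ℓ
-- connected pieces whose union has cost at most c(T)/4 and prize at least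
-- (1 − 2^(−ℓ)) p(T)/4: joining them to the root costs at most ℓχ more, so the
-- result competes with Tᵢ.
-- A centroid argument shows that a tree t with p(t) ≥ λ · max(c(t), s) has a
-- connected piece u with c(u) ≤ s and p(u) ≥ λ · max(c(u), s/2).  After setting
-- the costs and prizes of u to zero, iterating with the remaining budget s − c(u)
-- halves the missing prize each time.

open import Defs
import Data.Nat as ℕ
open import Data.Nat using (ℕ; zero; suc; _^_; _∸_; z≤n; s≤s)
import Data.Nat.Properties as ℕP
open import Data.Bool using (Bool; true; false; if_then_else_; _∧_; _∨_; not)
open import Data.Empty using (⊥)
open import Data.Fin as Fin using (Fin; zero; suc)
open import Data.List using (List; []; _∷_; _++_; [_]; map; foldr; concatMap; length; allFin)
open import Data.List.Properties using (++-assoc; ++-identityʳ)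
open import Data.List.Membership.Propositional using (_∈_; _∉_)
import Data.List.Membership.DecPropositional as DecMembership
open import Data.List.Membership.Propositional.Properties
  using (∈-++⁺ˡ; ∈-++⁺ʳ; ∈-++⁻; ∈-allFin; ∈-map⁺; ∈-map⁻)
open import Data.List.Relation.Unary.All as All using (All; []; _∷_)
import Data.List.Relation.Unary.All.Properties as All
open import Data.List.Relation.Unary.AllPairs using ([]; _∷_)
open import Data.List.Relation.Unary.Any using (here; there)
open import Data.List.Relation.Unary.Unique.Propositional using (Unique)
import Data.List.Relation.Unary.Unique.Propositional.Properties as Unique
open import Data.List.Relation.Binary.Permutation.Propositional as Perm
  using (_↭_; prep; swap; ↭-refl; ↭-sym; ↭-trans; ↭-reflexive; ↭⇒↭ₛ; module PermutationReasoning)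
open import Data.List.Relation.Binary.Permutation.Propositional.Properties
  using (++⁺ˡ; ++⁺ʳ; ++-comm; shift; shifts; ∈-resp-↭)
import Data.List.Relation.Binary.Permutation.Setoid.Properties as PermSetoid
open import Data.Product using (Σ-syntax; ∃-syntax; _×_; _,_; proj₁; proj₂)
open import Data.Sum using (_⊎_; inj₁; inj₂; [_,_]′)
open import Data.Sum.Properties using (≡-dec; inj₁-injective; inj₂-injective)
open import Data.Unit using (⊤)
open import Function using (_∘_)
open import Relation.Nullary using (¬_; Dec; yes; no; contradiction)
open import Relation.Nullary.Decidable using (⌊_⌋; _×-dec_; decidable-stable)
open import Relation.Binary using (IsTotalOrder)
open import Relation.Binary.Definitions using (DecidableEquality)
open import Relation.Binary.PropositionalEquality
  using (_≡_; _≢_; refl; sym; trans; cong; cong₂; subst; subst₂; setoid)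
open import Algebra.Bundles using (CommutativeRing)
import Algebra.Properties.Ring as RingProperties
import Algebra.Solver.Ring.NaturalCoefficients.Default as SemiringSolver

-- The shift is `(4ℓ - 1)χ` and not `4ℓχ` because phases `0` to `i` together cost at most
-- `(2^(i+1) - 1)χ`: the geometric sum leaves one `χ` to spare. The quarter comes from two
-- doublings. The next phase `i + 1` is only sure to end in time once the bound reaches `2^(i+2) χ`,
-- while `Tᵢ` is optimal only for cost `2^i χ`. A quarter of the bound `B + 4ℓχ` pays for pieces of
-- cost `B / 4` and for `ℓ` connections of cost `χ`. Setting the weights of `u` to zero, instead of
-- cutting `u` out, keeps the tree connected, but later pieces may then overlap earlier ones. Costs
-- and prizes are therefore measured on unions, each vertex or edge counted once. Pieces joined to
-- the root may form cycles, so a rooted subtree has to be chosen inside their union; this happens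
-- under a double negation.

module OrderedFieldProperties (F : OrderedField) where
  open OrderedField F

  commutativeRing : CommutativeRing _ _
  commutativeRing = record { isCommutativeRing = isCommutativeRing }

  open CommutativeRing commutativeRing public
    using (+-assoc; +-comm; +-identityˡ; +-identityʳ; *-assoc; *-comm;
           *-identityˡ; *-identityʳ; distribˡ; distribʳ; zeroˡ; zeroʳ;
           -‿inverseʳ; -‿inverseˡ; ring; commutativeSemiring)
  open RingProperties ring using (-‿distribʳ-*; -‿involutive)
  open SemiringSolver commutativeSemiring public
    using (solve; con; _:+_; _:*_; _:=_)
  open IsTotalOrder isTotalOrder public
    using (total; antisym)
    renaming (refl to ≤-refl; trans to ≤-trans; reflexive to ≤-reflexive)

  ≰⇒≥ : ∀ {x y} → ¬ x ≤ y → y ≤ x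
  ≰⇒≥ {x} {y} x≰y with total x y
  ... | inj₁ x≤y = contradiction x≤y x≰y
  ... | inj₂ y≤x = y≤x

  +-mono : ∀ {a b c d} → a ≤ b → c ≤ d → a + c ≤ b + d
  +-mono {a} {b} {c} {d} a≤b c≤d = ≤-trans (+-mono-≤ c a≤b)
    (subst₂ _≤_ (+-comm c b) (+-comm d b) (+-mono-≤ b c≤d))

  +-cancelʳ-≤ : ∀ {a b} c → a + c ≤ b + c → a ≤ b
  +-cancelʳ-≤ {a} {b} c a+c≤b+c = subst₂ _≤_ (cancel a) (cancel b) (+-mono-≤ (- c) a+c≤b+c)
    where
    cancel : ∀ x → x + c + - c ≡ x
    cancel x = trans (+-assoc x c (- c)) (trans (cong (x +_) (-‿inverseʳ c)) (+-identityʳ x))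

  x-y+y : ∀ x y → x + - y + y ≡ x
  x-y+y x y = trans (+-assoc x (- y) y) (trans (cong (x +_) (-‿inverseˡ y)) (+-identityʳ x))

  -- Transfers an inequality along y − x = b − a, stated without subtraction
  -- so that the premise is an identity of commutative semirings.
  ≤-via : ∀ {a b x y} → a ≤ b → x + b ≡ y + a → x ≤ y
  ≤-via {a} {b} {x} {y} a≤b eq = +-cancelʳ-≤ b
    (subst (_≤ y + b) (sym eq) (+-mono (≤-refl {y}) a≤b))

  x≤x+y : ∀ {x y} → 0# ≤ y → x ≤ x + y
  x≤x+y {x} {y} 0≤y = ≤-via 0≤y (sym (+-identityʳ (x + y)))

  y≤x+y : ∀ {x y} → 0# ≤ x → y ≤ x + y
  y≤x+y {x} {y} 0≤x = subst (y ≤_) (+-comm y x) (x≤x+y 0≤x)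

  +-nonneg : ∀ {x y} → 0# ≤ x → 0# ≤ y → 0# ≤ x + y
  +-nonneg 0≤x 0≤y = ≤-trans 0≤x (x≤x+y 0≤y)

  -- 0 ≤ (b − a)(d − c), multiplied out.
  *-rearrangement : ∀ {a b c d} → a ≤ b → c ≤ d → a * d + b * c ≤ a * c + b * d
  *-rearrangement {a} {b} {c} {d} a≤b c≤d = ≤-via (*-nonneg (0≤- a≤b) (0≤- c≤d)) eq
    where
    0≤- : ∀ {x y} → x ≤ y → 0# ≤ y + - x
    0≤- {x} {y} x≤y = subst (_≤ y + - x) (-‿inverseʳ x) (+-mono-≤ (- x) x≤y)
    diff : ∀ x y → x + (y + - x) ≡ y
    diff x y = trans (+-comm x _) (x-y+y y x)
    eq : a * d + b * c + (b + - a) * (d + - c) ≡ a * c + b * d + 0#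
    eq = subst₂ (λ b′ d′ → a * d′ + b′ * c + (b + - a) * (d + - c) ≡ a * c + b′ * d′ + 0#)
      (diff a b) (diff c d)
      (solve 4 (λ a x c y → a :* (c :+ y) :+ (a :+ x) :* c :+ x :* y
                          := a :* c :+ (a :+ x) :* (c :+ y) :+ con 0) refl
             a (b + - a) c (d + - c))

  *-monoˡ-≤ : ∀ {a b} k → 0# ≤ k → a ≤ b → k * a ≤ k * b
  *-monoˡ-≤ {a} {b} k 0≤k a≤b = ≤-via (*-rearrangement 0≤k a≤b)
    (solve 3 (λ k a b → k :* a :+ (con 0 :* a :+ k :* b) := k :* b :+ (con 0 :* b :+ k :* a)) refl k a b)

  *-monoʳ-≤ : ∀ {a b} k → 0# ≤ k → a ≤ b → a * k ≤ b * k
  *-monoʳ-≤ {a} {b} k 0≤k a≤b = subst₂ _≤_ (*-comm k a) (*-comm k b) (*-monoˡ-≤ k 0≤k a≤b)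

  *-cancelˡ : ∀ {a b} k → k ≢ 0# → k * a ≡ k * b → a ≡ b
  *-cancelˡ {a} {b} k k≢0 ka≡kb = trans (sym (undo a)) (trans (cong (k ⁻¹ *_) ka≡kb) (undo b))
    where
    undo : ∀ x → k ⁻¹ * (k * x) ≡ x
    undo x = trans (sym (*-assoc (k ⁻¹) k x)) (trans (cong (_* x)
      (trans (*-comm (k ⁻¹) k) (⁻¹-inverse k k≢0))) (*-identityˡ x))

  ≰0⇒≢0 : ∀ {x} → ¬ x ≤ 0# → x ≢ 0#
  ≰0⇒≢0 x≰0 x≡0 = x≰0 (≤-reflexive x≡0)

  *-cancelˡ-≤ : ∀ {a b} k → ¬ k ≤ 0# → k * a ≤ k * b → a ≤ b
  *-cancelˡ-≤ {a} {b} k k≰0 ka≤kb with total a b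
  ... | inj₁ a≤b = a≤b
  ... | inj₂ b≤a = ≤-reflexive (*-cancelˡ k (≰0⇒≢0 k≰0)
                     (antisym ka≤kb (*-monoˡ-≤ k (≰⇒≥ k≰0) b≤a)))

  0≤1 : 0# ≤ 1#
  0≤1 with total 0# 1#
  ... | inj₁ 0≤1 = 0≤1
  ... | inj₂ 1≤0 = subst (0# ≤_)
      (trans (sym (-‿distribʳ-* (- 1#) 1#)) (trans (cong -_ (*-identityʳ (- 1#))) (-‿involutive 1#)))
      (*-nonneg 0≤-1 0≤-1)
    where
    0≤-1 : 0# ≤ - 1#
    0≤-1 = subst₂ _≤_ (-‿inverseʳ 1#) (+-identityˡ (- 1#)) (+-mono-≤ (- 1#) 1≤0)

  1≰0 : ¬ 1# ≤ 0#
  1≰0 1≤0 = 0≢1 (antisym 0≤1 1≤0)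

  ⁻¹-nonneg : ∀ {x} → ¬ x ≤ 0# → 0# ≤ x ⁻¹
  ⁻¹-nonneg {x} x≰0 = ≰⇒≥ (λ x⁻¹≤0 → 1≰0 (subst₂ _≤_
      (⁻¹-inverse x (≰0⇒≢0 x≰0)) (zeroʳ x) (*-monoˡ-≤ x (≰⇒≥ x≰0) x⁻¹≤0)))

  ℕ→F-nonneg : ∀ k → 0# ≤ ℕ→F k
  ℕ→F-nonneg zero    = ≤-refl
  ℕ→F-nonneg (suc k) = +-nonneg 0≤1 (ℕ→F-nonneg k)

  ℕ→F-mono : ∀ {a b} → a ℕ.≤ b → ℕ→F a ≤ ℕ→F b
  ℕ→F-mono {b = b} z≤n = ℕ→F-nonneg b
  ℕ→F-mono (s≤s a≤b)   = +-mono ≤-refl (ℕ→F-mono a≤b)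

  ℕ→F-+ : ∀ a b → ℕ→F (a ℕ.+ b) ≡ ℕ→F a + ℕ→F b
  ℕ→F-+ zero    b = sym (+-identityˡ _)
  ℕ→F-+ (suc a) b = trans (cong (1# +_) (ℕ→F-+ a b)) (sym (+-assoc 1# _ _))

  ℕ→F-* : ∀ a b → ℕ→F (a ℕ.* b) ≡ ℕ→F a * ℕ→F b
  ℕ→F-* zero    b = sym (zeroˡ _)
  ℕ→F-* (suc a) b = trans (ℕ→F-+ b (a ℕ.* b)) (trans (cong (ℕ→F b +_) (ℕ→F-* a b))
    (solve 2 (λ a b → b :+ a :* b := (con 1 :+ a) :* b) refl (ℕ→F a) (ℕ→F b)))

  ℕ→F-suc≰0 : ∀ k → ¬ ℕ→F (suc k) ≤ 0#
  ℕ→F-suc≰0 k le = 1≰0 (≤-trans (x≤x+y (ℕ→F-nonneg k)) le)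

  sumF-cong : ∀ {k} {f g : Fin k → Carrier} → (∀ i → f i ≡ g i) → sumF f ≡ sumF g
  sumF-cong {zero}  eq = refl
  sumF-cong {suc k} eq = cong₂ _+_ (eq zero) (sumF-cong (λ i → eq (suc i)))

  sumF-mono : ∀ {k} {f g : Fin k → Carrier} → (∀ i → f i ≤ g i) → sumF f ≤ sumF g
  sumF-mono {zero}  le = ≤-refl
  sumF-mono {suc k} le = +-mono (le zero) (sumF-mono (λ i → le (suc i)))

  sumF-0 : ∀ k → sumF {k} (λ _ → 0#) ≡ 0#
  sumF-0 zero    = refl
  sumF-0 (suc k) = trans (+-identityˡ _) (sumF-0 k)

  sumF-nonneg : ∀ {k} {f : Fin k → Carrier} → (∀ i → 0# ≤ f i) → 0# ≤ sumF f
  sumF-nonneg {k} {f} 0≤f = subst (_≤ sumF f) (sumF-0 k) (sumF-mono 0≤f)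

  sumF-+ : ∀ {k} (f g : Fin k → Carrier) → sumF (λ i → f i + g i) ≡ sumF f + sumF g
  sumF-+ {zero}  f g = sym (+-identityˡ 0#)
  sumF-+ {suc k} f g = trans (cong (f zero + g zero +_) (sumF-+ (λ i → f (suc i)) (λ i → g (suc i))))
    (solve 4 (λ a b c d → a :+ b :+ (c :+ d) := a :+ c :+ (b :+ d)) refl _ _ _ _)

  term≤sumF : ∀ {k} {f : Fin k → Carrier} → (∀ i → 0# ≤ f i) → ∀ i → f i ≤ sumF f
  term≤sumF 0≤f zero    = x≤x+y (sumF-nonneg (λ i → 0≤f (suc i)))
  term≤sumF 0≤f (suc i) = ≤-trans (term≤sumF (λ i → 0≤f (suc i)) i) (y≤x+y (0≤f zero))

  total-of : {A : Set} → (A → Carrier) → List A → Carrier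
  total-of w = foldr (λ x acc → w x + acc) 0#

  total-of-++ : {A : Set} (w : A → Carrier) (xs : List A) {ys : List A} →
                total-of w (xs ++ ys) ≡ total-of w xs + total-of w ys
  total-of-++ w []       = sym (+-identityˡ _)
  total-of-++ w (x ∷ xs) = trans (cong (w x +_) (total-of-++ w xs)) (sym (+-assoc _ _ _))

  total-of-↭ : {A : Set} (w : A → Carrier) {xs ys : List A} → xs ↭ ys →
               total-of w xs ≡ total-of w ys
  total-of-↭ w Perm.refl         = refl
  total-of-↭ w (Perm.prep x p)   = cong (w x +_) (total-of-↭ w p)
  total-of-↭ w (Perm.swap x y p) = trans (cong (λ z → w x + (w y + z)) (total-of-↭ w p))
    (solve 3 (λ a b c → a :+ (b :+ c) := b :+ (a :+ c)) refl _ _ _)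
  total-of-↭ w (Perm.trans p q)  = trans (total-of-↭ w p) (total-of-↭ w q)

  total-of-mono : {A : Set} {w w′ : A → Carrier} (xs : List A) →
                  (∀ {x} → x ∈ xs → w x ≤ w′ x) → total-of w xs ≤ total-of w′ xs
  total-of-mono []       le = ≤-refl
  total-of-mono (x ∷ xs) le = +-mono (le (here refl)) (total-of-mono xs (le ∘ there))

  total-of-nonneg : {A : Set} (w : A → Carrier) → (∀ x → 0# ≤ w x) → ∀ xs → 0# ≤ total-of w xs
  total-of-nonneg w 0≤w []       = ≤-refl
  total-of-nonneg w 0≤w (x ∷ xs) = +-nonneg (0≤w x) (total-of-nonneg w 0≤w xs)

-- Trees and the vertices and edges they contain.

module Trees (V E : Set) where

  Item : Set
  Item = V ⊎ E

  -- Cutting any edge is symmetric in this encoding: graft t e s and graft s e t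
  -- are the same unrooted tree, rooted at the two ends of e.
  data Tree : Set where
    leaf  : V → Tree
    graft : Tree → E → Tree → Tree

  treeRoot : Tree → V
  treeRoot (leaf v)      = v
  treeRoot (graft t _ _) = treeRoot t

  items : Tree → List Item
  items (leaf v)      = [ inj₁ v ]
  items (graft t e s) = inj₂ e ∷ items t ++ items s

  infix 4 _⊑_
  -- Only multisets of items are compared, because pieces get re-rooted and regrouped and need not
  -- be syntactic subtrees. That a piece is connected is recorded by `Valid`.
  record _⊑_ (s t : Tree) : Set where
    constructor complement
    field
      rest     : List Item
      splits-↭ : items t ↭ items s ++ rest

  ⊑-of-↭ : ∀ {s t} → items t ↭ items s → s ⊑ t
  ⊑-of-↭ {s} p = complement [] (↭-trans p (↭-reflexive (sym (++-identityʳ (items s)))))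

  ⊑-refl : ∀ {t} → t ⊑ t
  ⊑-refl = ⊑-of-↭ ↭-refl

  ⊑-trans : ∀ {r s t} → r ⊑ s → s ⊑ t → r ⊑ t
  ⊑-trans {r} (complement xs p) (complement ys q) = complement (xs ++ ys)
    (↭-trans q (↭-trans (++⁺ʳ ys p) (↭-reflexive (++-assoc (items r) xs ys))))

  graft-comm : ∀ {t e s} → items (graft t e s) ↭ items (graft s e t)
  graft-comm {t} {e} {s} = prep (inj₂ e) (++-comm (items t) (items s))

  ⊑-graftˡ : ∀ {t e s} → t ⊑ graft t e s
  ⊑-graftˡ {t} {e} {s} = complement (inj₂ e ∷ items s) (↭-sym (shift (inj₂ e) (items t) (items s)))

  ⊑-graftʳ : ∀ {t e s} → s ⊑ graft t e s
  ⊑-graftʳ {t} {e} {s} = complement (inj₂ e ∷ items t)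
    (↭-trans (graft-comm {t} {e} {s}) (↭-sym (shift (inj₂ e) (items s) (items t))))

  Branch : Set
  Branch = E × Tree

  attach : Tree → List Branch → Tree
  attach t []             = t
  attach t ((e , s) ∷ bs) = graft (attach t bs) e s

  -- Makes `e` the outermost edge although branches hang from the root: cutting `e` then separates
  -- `s` from `t` together with its branches.
  attach-graft : ∀ t e s bs → items (attach (graft t e s) bs) ↭ items (graft (attach t bs) e s)
  attach-graft t e s []              = ↭-refl
  attach-graft t e s ((e′ , s′) ∷ bs) = begin
      inj₂ e′ ∷ items (attach (graft t e s) bs) ++ items s′
        ↭⟨ prep _ (++⁺ʳ (items s′) (attach-graft t e s bs)) ⟩
      inj₂ e′ ∷ inj₂ e ∷ (items t′ ++ items s) ++ items s′
        ↭⟨ swap _ _ (↭-reflexive (++-assoc (items t′) (items s) (items s′))) ⟩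
      inj₂ e ∷ inj₂ e′ ∷ items t′ ++ items s ++ items s′
        ↭⟨ prep _ (prep _ (++⁺ˡ (items t′) (++-comm (items s) (items s′)))) ⟩
      inj₂ e ∷ inj₂ e′ ∷ items t′ ++ items s′ ++ items s
        ≡⟨ cong (λ z → inj₂ e ∷ inj₂ e′ ∷ z) (sym (++-assoc (items t′) (items s′) (items s))) ⟩
      inj₂ e ∷ inj₂ e′ ∷ (items t′ ++ items s′) ++ items s ∎
    where
    open PermutationReasoning
    t′ = attach t bs

  module _ (src tgt : E → V) where

    Joins : E → V → V → Set
    Joins e u v = (src e ≡ u × tgt e ≡ v) ⊎ (src e ≡ v × tgt e ≡ u)

    Joins-sym : ∀ {e u v} → Joins e u v → Joins e v u
    Joins-sym (inj₁ j) = inj₂ j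
    Joins-sym (inj₂ j) = inj₁ j

    Valid : Tree → Set
    Valid (leaf _)      = ⊤
    Valid (graft t e s) = Joins e (treeRoot t) (treeRoot s) × Valid t × Valid s

    BranchAt : V → Branch → Set
    BranchAt u (e , s) = Joins e u (treeRoot s) × Valid s

    attach-root : ∀ t bs → treeRoot (attach t bs) ≡ treeRoot t
    attach-root t []       = refl
    attach-root t (_ ∷ bs) = attach-root t bs

    attach-valid : ∀ t {bs} → Valid t → All (BranchAt (treeRoot t)) bs → Valid (attach t bs)
    attach-valid t vt []                          = vt
    attach-valid t {(e , s) ∷ bs} vt ((j , vs) ∷ vbs) =
      subst (λ u → Joins e u (treeRoot s)) (sym (attach-root t bs)) j ,
      attach-valid t vt vbs , vs

  -- Extraction of a dense piece from a weighted tree.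

  module Weights (F : OrderedField) where
    open OrderedField F
    open OrderedFieldProperties F

    costItem : (E → Carrier) → Item → Carrier
    costItem c = [ (λ _ → 0#) , c ]′

    prizeItem : (V → Carrier) → Item → Carrier
    prizeItem p = [ p , (λ _ → 0#) ]′

    prizeOf : (V → Carrier) → Tree → Carrier
    prizeOf p t = total-of (prizeItem p) (items t)

    costOf : (E → Carrier) → Tree → Carrier
    costOf c t = total-of (costItem c) (items t)

    prizeOf-graft : ∀ p t e s → prizeOf p (graft t e s) ≡ prizeOf p t + prizeOf p s
    prizeOf-graft p t e s = trans (+-identityˡ _) (total-of-++ _ (items t))

    costOf-graft : ∀ c t e s → costOf c (graft t e s) ≡ c e + (costOf c t + costOf c s)
    costOf-graft c t e s = cong (c e +_) (total-of-++ _ (items t))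

    -- If both sides of an edge of cost x miss the target density, the side
    -- opposite to an expensive one is cheap but dense enough to pay for the edge.
    light-opposite : ∀ lam h {a b x pa pb} → 0# ≤ lam → 0# ≤ x → h ≤ a → lam * (x + (a + b)) ≤ pa + pb →
                     ¬ (lam * h ≤ pa × lam * a ≤ pa) → ¬ (lam * h ≤ pb × lam * b ≤ pb) →
                     x + b ≤ h × lam * (x + b) ≤ pb
    light-opposite lam h {a} {b} {x} {pa} {pb} 0≤λ 0≤x h≤a dense ¬a ¬b =
        ≰⇒≥ (λ h≤x+b → ¬b (≤-trans (*-monoˡ-≤ lam 0≤λ h≤x+b) x+b-dense ,
                           ≤-trans (*-monoˡ-≤ lam 0≤λ (y≤x+y 0≤x)) x+b-dense)) ,
        x+b-dense
      where
      pa≤λa : pa ≤ lam * a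
      pa≤λa = ≰⇒≥ λ λa≤pa → ¬a (≤-trans (*-monoˡ-≤ lam 0≤λ h≤a) λa≤pa , λa≤pa)
      x+b-dense : lam * (x + b) ≤ pb
      x+b-dense = ≤-via (+-mono dense pa≤λa)
        (solve 6 (λ l x a b pa pb → l :* (x :+ b) :+ (pa :+ pb :+ l :* a)
                   := pb :+ (l :* (x :+ (a :+ b)) :+ pa)) refl lam x a b pa pb)

    -- If one side costs at least `h`, `light-opposite` applies to the other. If neither does,
    -- failing the density test means a prize below `lam * h` on each side, too little for a total
    -- cost of at least `2h`.
    light-side : ∀ lam h {a b x pa pb} → 0# ≤ lam → 0# ≤ x → h + h ≤ x + (a + b) →
                 lam * (x + (a + b)) ≤ pa + pb →
                 ¬ (lam * h ≤ pa × lam * a ≤ pa) → ¬ (lam * h ≤ pb × lam * b ≤ pb) →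
                 (x + a ≤ h × lam * (x + a) ≤ pa) ⊎ (x + b ≤ h × lam * (x + b) ≤ pb)
    light-side lam h {a} {b} {x} {pa} {pb} 0≤λ 0≤x big dense ¬a ¬b with total h a | total h b
    ... | inj₁ h≤a | _ = inj₂ (light-opposite lam h 0≤λ 0≤x h≤a dense ¬a ¬b)
    ... | inj₂ a≤h | inj₁ h≤b = inj₁ (light-opposite lam h 0≤λ 0≤x h≤b
      (subst₂ (λ u v → lam * (x + u) ≤ v) (+-comm a b) (+-comm pa pb) dense) ¬b ¬a)
    ... | inj₂ a≤h | inj₂ b≤h = contradiction (a-dense , ≤-trans (*-monoˡ-≤ lam 0≤λ a≤h) a-dense) ¬a
      where
      pb≤λh : pb ≤ lam * h
      pb≤λh = ≰⇒≥ λ λh≤pb → ¬b (λh≤pb , ≤-trans (*-monoˡ-≤ lam 0≤λ b≤h) λh≤pb)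
      a-dense : lam * h ≤ pa
      a-dense = ≤-via (+-mono (+-mono (*-monoˡ-≤ lam 0≤λ big) dense) pb≤λh)
        (solve 5 (λ l h s pa pb → l :* h :+ (l :* s :+ (pa :+ pb) :+ l :* h)
                   := pa :+ (l :* (h :+ h) :+ l :* s :+ pb)) refl lam h (x + (a + b)) pa pb)

    -- `h` is half of the budget `s`: `Dense` is the condition `P ≥ lam · max(C, s/2)`, split into
    -- two inequalities, and the bound `h + h` in `Piece` is `s`.
    module DensePiece (src tgt : E → V)
                      (p : V → Carrier) (0≤p : ∀ v → 0# ≤ p v)
                      (c : E → Carrier) (0≤c : ∀ e → 0# ≤ c e)
                      (lam h : Carrier) (0≤λ : 0# ≤ lam) (0≤h : 0# ≤ h) where

      private
        P C : Tree → Carrier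
        P = prizeOf p
        C = costOf c

      Dense : Tree → Set
      Dense t = lam * h ≤ P t × lam * C t ≤ P t

      dense? : ∀ t → Dec (Dense t)
      dense? t = ((lam * h) ≤? P t) ×-dec ((lam * C t) ≤? P t)

      Dense-↭ : ∀ {s t} → items s ↭ items t → Dense s → Dense t
      Dense-↭ q = subst₂ (λ w k → lam * h ≤ w × lam * k ≤ w) (total-of-↭ _ q) (total-of-↭ _ q)

      Light : Branch → Set
      Light (e , s) = c e + C s ≤ h × lam * (c e + C s) ≤ P s

      -- A light branch also pays for its connecting edge. A star of light branches around one
      -- vertex, which itself costs nothing, therefore meets the density however many there are.
      light-branches-dense : ∀ v {bs} → All Light bs →
        lam * C (attach (leaf v) bs) ≤ P (attach (leaf v) bs)
      light-branches-dense v [] = subst₂ _≤_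
        (sym (trans (cong (lam *_) (+-identityʳ 0#)) (zeroʳ lam))) (sym (+-identityʳ (p v))) (0≤p v)
      light-branches-dense v {(e , s) ∷ bs} ((_ , dense) ∷ ls) =
        subst₂ _≤_ (trans (sym (distribˡ lam _ _)) (cong (lam *_) rearrange))
          (sym (prizeOf-graft p (attach (leaf v) bs) e s))
          (+-mono (light-branches-dense v ls) dense)
        where
        rearrange : C (attach (leaf v) bs) + (c e + C s) ≡ C (attach (leaf v) ((e , s) ∷ bs))
        rearrange = trans (solve 3 (λ a x b → a :+ (x :+ b) := x :+ (a :+ b)) refl _ _ _)
          (sym (costOf-graft c (attach (leaf v) bs) e s))

      Piece : Tree → Set
      Piece t = Σ[ s ∈ Tree ] Valid src tgt s × s ⊑ t × Dense s × C s ≤ h + h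

      Piece-⊑ : ∀ {s t} → s ⊑ t → Piece s → Piece t
      Piece-⊑ s⊑t (r , v , r⊑s , d , k) = r , v , ⊑-trans r⊑s s⊑t , d , k

      -- Walks towards a centroid: t is the part still to be searched, and
      -- everything already passed hangs from its root as light branches.
      extract : ∀ t bs → Valid src tgt t → All (BranchAt src tgt (treeRoot t)) bs → All Light bs →
                Dense (attach t bs) → Piece (attach t bs)
      extract t bs vt vbs ls d with C (attach t bs) ≤? (h + h)
      ... | yes cheap = attach t bs , attach-valid src tgt t vt vbs , ⊑-refl , d , cheap
      extract (leaf v) [] vt vbs ls d | no ¬cheap =
        contradiction (subst (_≤ h + h) (sym (+-identityʳ 0#)) (+-nonneg 0≤h 0≤h)) ¬cheap
      -- The centroid is reached. A branch with its edge costs at most `h`, so dropping one leaves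
      -- cost at least `h`; the other branches still have density `lam`, which then also yields
      -- prize `lam * h`.
      extract (leaf v) ((e , s) ∷ bs) vt (_ ∷ vbs) ((b≤h , _) ∷ ls) d | no ¬cheap =
        Piece-⊑ ⊑-graftˡ (extract (leaf v) bs vt vbs ls
          (≤-trans (*-monoˡ-≤ lam 0≤λ h≤rest) rest-dense , rest-dense))
        where
        rest-dense = light-branches-dense v ls
        h≤rest : h ≤ C (attach (leaf v) bs)
        h≤rest = ≤-via (+-mono (≰⇒≥ ¬cheap) b≤h)
          (trans (cong (λ z → h + (z + h)) (costOf-graft c (attach (leaf v) bs) e s))
            (solve 4 (λ h x a b → h :+ (x :+ (a :+ b) :+ h) := a :+ (h :+ h :+ (x :+ b))) refl _ _ _ _))
      extract (graft t e s) bs (j , vt , vs) vbs ls d | no ¬cheap = result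
        where
        u = attach t bs
        q = attach-graft t e s bs
        split⊑ : ∀ {r} → r ⊑ graft u e s → Piece r → Piece (attach (graft t e s) bs)
        split⊑ r⊑ = Piece-⊑ (⊑-trans r⊑ (⊑-of-↭ q))
        j′ : Joins src tgt e (treeRoot u) (treeRoot s)
        j′ = subst (λ x → Joins src tgt e x (treeRoot s)) (sym (attach-root src tgt t bs)) j
        big : h + h ≤ c e + (C u + C s)
        big = subst (h + h ≤_) (trans (total-of-↭ _ q) (costOf-graft c u e s)) (≰⇒≥ ¬cheap)
        d′ : Dense (graft u e s)
        d′ = Dense-↭ {attach (graft t e s) bs} {graft u e s} q d
        dense : lam * (c e + (C u + C s)) ≤ P u + P s
        dense = subst₂ (λ k w → lam * k ≤ w) (costOf-graft c u e s) (prizeOf-graft p u e s) (proj₂ d′)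
        result : Piece (attach (graft t e s) bs)
        result with dense? s | dense? u
        ... | yes ds | _ = split⊑ ⊑-graftʳ (extract s [] vs [] [] ds)
        ... | no _ | yes du = split⊑ ⊑-graftˡ (extract t bs vt vbs ls du)
        -- Neither side is dense, so one of them is light together with `e`. It becomes a branch and
        -- the search moves to the other side.
        ... | no ¬ds | no ¬du with light-side lam h 0≤λ (0≤c e) big dense ¬du ¬ds
        ...   | inj₂ light-s = split⊑ ⊑-refl
                (extract t ((e , s) ∷ bs) vt ((j , vs) ∷ vbs) (light-s ∷ ls) d′)
        -- The tree is re-rooted at the far end of `e`, and all earlier branches disappear inside
        -- the single branch `u`. The part to be searched shrinks to `s`, so the recursion is
        -- structural.
        ...   | inj₁ light-u = split⊑ (⊑-of-↭ (graft-comm {u} {e} {s}))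
                (extract s ((e , u) ∷ []) vs
                  ((Joins-sym src tgt j′ , attach-valid src tgt t vt vbs) ∷ []) (light-u ∷ [])
                  (Dense-↭ {graft u e s} {graft s e u} (graft-comm {u} {e} {s}) d′))

-- Repetition-free lists and the weight of unions.

Unique-resp-↭ : {A : Set} {xs ys : List A} → xs ↭ ys → Unique xs → Unique ys
Unique-resp-↭ p = PermSetoid.Unique-resp-↭ (setoid _) (↭⇒↭ₛ p)

Unique-++⁻ˡ : {A : Set} (xs : List A) {ys : List A} → Unique (xs ++ ys) → Unique xs
Unique-++⁻ˡ []       _          = []
Unique-++⁻ˡ (x ∷ xs) (x# ∷ xs#) = All.++⁻ˡ xs x# ∷ Unique-++⁻ˡ xs xs#

Unique-++⁻-disjoint : {A : Set} (xs : List A) {ys : List A} {x : A} →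
                      Unique (xs ++ ys) → x ∈ xs → x ∉ ys
Unique-++⁻-disjoint (x ∷ xs) (x# ∷ _)  (here refl) x∈ys = All.lookup (All.++⁻ʳ xs x#) x∈ys refl
Unique-++⁻-disjoint (x ∷ xs) (_ ∷ xs#) (there x∈xs)  x∈ys = Unique-++⁻-disjoint xs xs# x∈xs x∈ys

module Covers (F : OrderedField) {A : Set} (_≟_ : DecidableEquality A) where
  open OrderedField F
  open OrderedFieldProperties F
  open DecMembership _≟_ using (_∈?_)

  sumF-single : ∀ {k} (j : Fin k) x → sumF (λ i → if ⌊ i Fin.≟ j ⌋ then x else 0#) ≡ x
  sumF-single {suc k} zero    x = trans (cong (x +_) (sumF-0 k)) (+-identityʳ x)
  sumF-single {suc k} (suc j) x = trans (+-identityˡ _) (trans (sumF-cong step) (sumF-single j x))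
    where
    step : ∀ i → (if ⌊ suc i Fin.≟ suc j ⌋ then x else 0#) ≡ (if ⌊ i Fin.≟ j ⌋ then x else 0#)
    step i with i Fin.≟ j
    ... | yes _ = refl
    ... | no  _ = refl

  module _ {k} (ι : Fin k → A) where

    -- The weight of a union: an index counts once however often it is listed, unlike in `total-of`.
    cover : (Fin k → Carrier) → List A → Carrier
    cover f xs = sumF (λ i → if ⌊ ι i ∈? xs ⌋ then f i else 0#)

    off : List A → (Fin k → Carrier) → Fin k → Carrier
    off xs f i = if ⌊ ι i ∈? xs ⌋ then 0# else f i

    off-nonneg : ∀ xs {f} → (∀ i → 0# ≤ f i) → ∀ i → 0# ≤ off xs f i
    off-nonneg xs 0≤f i with ι i ∈? xs
    ... | yes _ = ≤-refl
    ... | no  _ = 0≤f i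

    -- What the second list adds is its weight after the first has been zeroed. This is the
    -- accounting behind iterating on reduced weights.
    cover-++ : ∀ f xs ys → cover f (xs ++ ys) ≡ cover f xs + cover (off xs f) ys
    cover-++ f xs ys = trans (sumF-cong {k} pointwise) (sumF-+ {k} _ _)
      where
      pointwise : ∀ i → (if ⌊ ι i ∈? (xs ++ ys) ⌋ then f i else 0#) ≡
                        (if ⌊ ι i ∈? xs ⌋ then f i else 0#) + (if ⌊ ι i ∈? ys ⌋ then off xs f i else 0#)
      pointwise i with ι i ∈? (xs ++ ys) | ι i ∈? xs | ι i ∈? ys
      ... | yes _ | yes _ | yes _ = sym (+-identityʳ _)
      ... | yes _ | yes _ | no  _ = sym (+-identityʳ _)
      ... | yes _ | no  _ | yes _ = sym (+-identityˡ _)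
      ... | yes m | no ¬x | no ¬y = contradiction (∈-++⁻ xs m) [ ¬x , ¬y ]′
      ... | no ¬m | yes x | _     = contradiction (∈-++⁺ˡ x) ¬m
      ... | no ¬m | no  _ | yes y = contradiction (∈-++⁺ʳ xs y) ¬m
      ... | no  _ | no  _ | no  _ = sym (+-identityˡ _)

    cover-mono : ∀ {f} → (∀ i → 0# ≤ f i) → {xs : List A} (S : Fin k → Bool) →
                 (∀ i → ι i ∈ xs → S i ≡ true) →
                 cover f xs ≤ sumF (λ i → if S i then f i else 0#)
    cover-mono {f} 0≤f {xs} S sub = sumF-mono pointwise
      where
      pointwise : ∀ i → (if ⌊ ι i ∈? xs ⌋ then f i else 0#) ≤ (if S i then f i else 0#)
      pointwise i with ι i ∈? xs
      ... | yes m rewrite sub i m = ≤-refl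
      ... | no  _ with S i
      ...   | true  = 0≤f i
      ...   | false = ≤-refl

    mono-cover : ∀ {f} → (∀ i → 0# ≤ f i) → {xs : List A} (S : Fin k → Bool) →
                 (∀ i → S i ≡ true → ι i ∈ xs) →
                 sumF (λ i → if S i then f i else 0#) ≤ cover f xs
    mono-cover {f} 0≤f {xs} S sub = sumF-mono pointwise
      where
      pointwise : ∀ i → (if S i then f i else 0#) ≤ (if ⌊ ι i ∈? xs ⌋ then f i else 0#)
      pointwise i with S i in eq | ι i ∈? xs
      ... | true  | yes _ = ≤-refl
      ... | true  | no ¬m = contradiction (sub i eq) ¬m
      ... | false | yes _ = 0≤f i
      ... | false | no  _ = ≤-refl

    module _ (ι-injective : ∀ {i j} → ι i ≡ ι j → i ≡ j)
             (w : A → Carrier) (f : Fin k → Carrier)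
             (view : ∀ x → (∃[ i ] (x ≡ ι i × w x ≡ f i)) ⊎ (w x ≡ 0# × ∀ i → x ≢ ι i)) where

      cover-[] : cover f [] ≡ 0#
      cover-[] = sumF-0 k

      private
        single : Fin k → Fin k → Carrier
        single j i = if ⌊ i Fin.≟ j ⌋ then f j else 0#

      cover-∷≤ : (∀ i → 0# ≤ f i) → ∀ x xs → cover f (x ∷ xs) ≤ w x + cover f xs
      cover-∷≤ 0≤f x xs with view x
      ... | inj₂ (wx≡0 , x∉ι) rewrite wx≡0 = ≤-trans (sumF-mono pointwise) (≤-reflexive (sym (+-identityˡ _)))
        where
        pointwise : ∀ i → (if ⌊ ι i ∈? (x ∷ xs) ⌋ then f i else 0#) ≤ (if ⌊ ι i ∈? xs ⌋ then f i else 0#)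
        pointwise i with ι i ≟ x | ι i ∈? xs
        ... | yes eq | _     = contradiction (sym eq) (x∉ι i)
        ... | no  _  | yes _ = ≤-refl
        ... | no  _  | no  _ = ≤-refl
      ... | inj₁ (j , refl , wx≡fj) rewrite wx≡fj =
        ≤-trans (sumF-mono pointwise) (≤-reflexive (trans (sumF-+ (single j) _)
          (cong (_+ cover f xs) (sumF-single j (f j)))))
        where
        pointwise : ∀ i → (if ⌊ ι i ∈? (ι j ∷ xs) ⌋ then f i else 0#) ≤
                          single j i + (if ⌊ ι i ∈? xs ⌋ then f i else 0#)
        pointwise i with i Fin.≟ j | ι i ≟ ι j | ι i ∈? xs
        ... | yes refl | yes _   | yes _ = x≤x+y (0≤f i)
        ... | yes refl | yes _   | no  _ = x≤x+y ≤-refl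
        ... | yes refl | no  i≢i | _     = contradiction refl i≢i
        ... | no  i≢j    | yes eq  | _     = contradiction (ι-injective eq) i≢j
        ... | no  _      | no  _   | yes _ = y≤x+y ≤-refl
        ... | no  _      | no  _   | no  _ = x≤x+y ≤-refl

      cover-∷≥ : ∀ {x xs} → x ∉ xs → w x + cover f xs ≤ cover f (x ∷ xs)
      cover-∷≥ {x} {xs} x∉xs with view x
      ... | inj₂ (wx≡0 , x∉ι) rewrite wx≡0 = ≤-trans (≤-reflexive (+-identityˡ _)) (sumF-mono pointwise)
        where
        pointwise : ∀ i → (if ⌊ ι i ∈? xs ⌋ then f i else 0#) ≤ (if ⌊ ι i ∈? (x ∷ xs) ⌋ then f i else 0#)
        pointwise i with ι i ≟ x | ι i ∈? xs
        ... | yes eq | _     = contradiction (sym eq) (x∉ι i)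
        ... | no  _  | yes _ = ≤-refl
        ... | no  _  | no  _ = ≤-refl
      ... | inj₁ (j , refl , wx≡fj) rewrite wx≡fj =
        ≤-trans (≤-reflexive (sym (trans (sumF-+ (single j) _)
          (cong (_+ cover f xs) (sumF-single j (f j)))))) (sumF-mono pointwise)
        where
        pointwise : ∀ i → single j i + (if ⌊ ι i ∈? xs ⌋ then f i else 0#) ≤
                          (if ⌊ ι i ∈? (ι j ∷ xs) ⌋ then f i else 0#)
        pointwise i with i Fin.≟ j | ι i ≟ ι j | ι i ∈? xs
        ... | yes refl | _       | yes m = contradiction m x∉xs
        ... | yes refl | yes _   | no  _ = ≤-reflexive (+-identityʳ _)
        ... | yes refl | no  i≢i | no  _ = contradiction refl i≢i
        ... | no  i≢j    | yes eq  | _     = contradiction (ι-injective eq) i≢j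
        ... | no  _      | no  _   | yes _ = ≤-reflexive (+-identityˡ _)
        ... | no  _      | no  _   | no  _ = ≤-reflexive (+-identityˡ _)

      cover≤total-of : (∀ i → 0# ≤ f i) → ∀ xs → cover f xs ≤ total-of w xs
      cover≤total-of 0≤f []       = ≤-reflexive cover-[]
      cover≤total-of 0≤f (x ∷ xs) = ≤-trans (cover-∷≤ 0≤f x xs) (+-mono ≤-refl (cover≤total-of 0≤f xs))

      total-of≤cover : ∀ {xs} → Unique xs → total-of w xs ≤ cover f xs
      total-of≤cover []         = ≤-reflexive (sym cover-[])
      total-of≤cover (x# ∷ xs#) = ≤-trans (+-mono ≤-refl (total-of≤cover xs#))
        (cover-∷≥ (λ x∈xs → All.lookup x# x∈xs refl))

-- Iterated extraction: up to `ℓ` pieces of one tree.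

module Pieces (F : OrderedField) {n m : ℕ} (src tgt : Fin m → Fin n) where
  open OrderedField F
  open OrderedFieldProperties F
  open Trees (Fin n) (Fin m) public
  open Weights F public

  infix 4 _≟ᵢ_
  _≟ᵢ_ : DecidableEquality Item
  _≟ᵢ_ = ≡-dec Fin._≟_ Fin._≟_

  open DecMembership _≟ᵢ_ using (_∈?_)
  open Covers F _≟ᵢ_ public

  coverV : (Fin n → Carrier) → List Item → Carrier
  coverV = cover inj₁

  coverE : (Fin m → Carrier) → List Item → Carrier
  coverE = cover inj₂

  prize-view : ∀ p x → (∃[ v ] (x ≡ inj₁ v × prizeItem p x ≡ p v)) ⊎ (prizeItem p x ≡ 0# × ∀ v → x ≢ inj₁ v)
  prize-view p (inj₁ v) = inj₁ (v , refl , refl)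
  prize-view p (inj₂ _) = inj₂ (refl , λ _ ())

  cost-view : ∀ c x → (∃[ e ] (x ≡ inj₂ e × costItem c x ≡ c e)) ⊎ (costItem c x ≡ 0# × ∀ e → x ≢ inj₂ e)
  cost-view c (inj₂ e) = inj₁ (e , refl , refl)
  cost-view c (inj₁ _) = inj₂ (refl , λ _ ())

  coverV≤total : ∀ {p} → (∀ v → 0# ≤ p v) → ∀ xs → coverV p xs ≤ total-of (prizeItem p) xs
  coverV≤total {p} = cover≤total-of inj₁ inj₁-injective (prizeItem p) p (prize-view p)

  total≤coverV : ∀ p {xs} → Unique xs → total-of (prizeItem p) xs ≤ coverV p xs
  total≤coverV p = total-of≤cover inj₁ inj₁-injective (prizeItem p) p (prize-view p)

  coverE≤total : ∀ {c} → (∀ e → 0# ≤ c e) → ∀ xs → coverE c xs ≤ total-of (costItem c) xs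
  coverE≤total {c} = cover≤total-of inj₂ inj₂-injective (costItem c) c (cost-view c)

  total≤coverE : ∀ c {xs} → Unique xs → total-of (costItem c) xs ≤ coverE c xs
  total≤coverE c = total-of≤cover inj₂ inj₂-injective (costItem c) c (cost-view c)

  Unique-⊑ : ∀ {s t} → s ⊑ t → Unique (items t) → Unique (items s)
  Unique-⊑ {s} (complement _ perm) unique = Unique-++⁻ˡ (items s) (Unique-resp-↭ perm unique)

  -- A vertex of the complement keeps its prize: the items of `t` are distinct, so it cannot also
  -- occur in `s` and be zeroed there.
  prize-off : ∀ {p s t} → (∀ v → 0# ≤ p v) → s ⊑ t → Unique (items t) →
              prizeOf p t ≤ prizeOf (off inj₁ (items s) p) t + prizeOf p s
  prize-off {p} {s} {t} 0≤p (complement rest perm) unique =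
    subst₂ _≤_ (sym (trans (total-of-↭ _ perm) (total-of-++ _ (items s))))
      (cong (_+ prizeOf p s) (sym (trans (total-of-↭ _ perm) (total-of-++ _ (items s)))))
      (≤-trans (+-mono (y≤x+y (total-of-nonneg _ off-prize≥0 (items s))) (total-of-mono rest outside))
        (≤-reflexive (solve 3 (λ z a b → z :+ a :+ b := z :+ b :+ a) refl _ _ _)))
    where
    p′ = off inj₁ (items s) p
    off-prize≥0 : ∀ x → 0# ≤ prizeItem p′ x
    off-prize≥0 (inj₁ v) = off-nonneg inj₁ (items s) 0≤p v
    off-prize≥0 (inj₂ _) = ≤-refl
    outside : ∀ {x} → x ∈ rest → prizeItem p x ≤ prizeItem p′ x
    outside {inj₂ _} _ = ≤-refl
    outside {inj₁ v} x∈rest with inj₁ v ∈? items s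
    ... | yes x∈s = contradiction x∈rest (Unique-++⁻-disjoint (items s) (Unique-resp-↭ perm unique) x∈s)
    ... | no  _   = ≤-refl

  cost-off : ∀ {c s t} → (∀ e → 0# ≤ c e) → s ⊑ t →
             costOf (off inj₂ (items s) c) t + costOf c s ≤ costOf c t
  cost-off {c} {s} {t} 0≤c (complement rest perm) =
    subst₂ _≤_ (cong (_+ costOf c s) (sym (trans (total-of-↭ _ perm) (total-of-++ _ (items s)))))
      (sym (trans (total-of-↭ _ perm) (total-of-++ _ (items s))))
      (≤-trans (+-mono (+-mono inside (total-of-mono rest outside)) ≤-refl)
        (≤-reflexive (solve 2 (λ a b → con 0 :+ b :+ a := a :+ b) refl _ _)))
    where
    c′ = off inj₂ (items s) c
    inside : total-of (costItem c′) (items s) ≤ 0#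
    inside = ≤-trans (total-of-mono {w′ = λ _ → 0#} (items s) vanish) (≤-reflexive (total-0 (items s)))
      where
      vanish : ∀ {x} → x ∈ items s → costItem c′ x ≤ 0#
      vanish {inj₁ _} _ = ≤-refl
      vanish {inj₂ e} x∈s with inj₂ e ∈? items s
      ... | yes _  = ≤-refl
      ... | no x∉s = contradiction x∈s x∉s
      total-0 : (xs : List Item) → total-of (λ _ → 0#) xs ≡ 0#
      total-0 []       = refl
      total-0 (_ ∷ xs) = trans (+-identityˡ _) (total-0 xs)
    outside : ∀ {x} → x ∈ rest → costItem c′ x ≤ costItem c x
    outside {inj₁ _} _ = ≤-refl
    outside {inj₂ e} _ with inj₂ e ∈? items s
    ... | yes _ = 0≤c e
    ... | no  _ = ≤-refl

  -- With λ′ = r / s′, this is λ′ c′ ≤ p′: the residual density suffices to iterate.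
  residual-dense : ∀ {lam r s s′ p₁ c₁ p′ c′ pt ct} → 0# ≤ lam → 0# ≤ r → 0# ≤ s′ → 0# ≤ p′ →
    lam * s ≡ p₁ + r → s ≡ s′ + c₁ → lam * c₁ ≤ p₁ → lam * ct ≤ pt → lam * s ≤ pt →
    pt ≤ p′ + p₁ → c′ + c₁ ≤ ct → r * c′ ≤ s′ * p′
  residual-dense {lam} {r} {s} {s′} {p₁} {c₁} {p′} {c′} {pt} {ct}
    0≤λ 0≤r 0≤s′ 0≤p′ λs≡ s≡ λc₁≤p₁ λct≤pt λs≤pt pt≤ c′+c₁≤ct with total c′ s′
  ... | inj₁ c′≤s′ = ≤-trans (*-monoˡ-≤ r 0≤r c′≤s′)
        (≤-trans (≤-reflexive (*-comm r s′)) (*-monoˡ-≤ s′ 0≤s′ r≤p′))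
    where
    r≤p′ : r ≤ p′
    r≤p′ = +-cancelʳ-≤ p₁ (≤-trans (≤-reflexive (trans (+-comm r p₁) (sym λs≡))) (≤-trans λs≤pt pt≤))
  -- Removing the first piece lowers the prize by its surplus `p₁ - lam * c₁` over density `lam`.
  -- The surplus is nonnegative and `s′ ≤ c′`, so weighting it with `c′` in place of `s′` only
  -- strengthens the deduction; what remains is `c′ * (lam * s - p₁) = c′ * r`.
  ... | inj₂ s′≤c′ = ≤-via (+-mono (*-monoˡ-≤ s′ 0≤s′ big) (*-rearrangement λc₁≤p₁ s′≤c′)) eq
    where
    big : lam * (c′ + c₁) ≤ p′ + p₁
    big = ≤-trans (*-monoˡ-≤ lam 0≤λ c′+c₁≤ct) (≤-trans λct≤pt pt≤)
    eq : r * c′ + (s′ * (p′ + p₁) + (lam * c₁ * s′ + p₁ * c′)) ≡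
         s′ * p′ + (s′ * (lam * (c′ + c₁)) + (lam * c₁ * c′ + p₁ * s′))
    eq = trans
      (solve 7 (λ r c′ s′ p′ p₁ l c₁ → r :* c′ :+ (s′ :* (p′ :+ p₁) :+ (l :* c₁ :* s′ :+ p₁ :* c′))
        := (p₁ :+ r) :* c′ :+ (s′ :* (p′ :+ p₁) :+ l :* c₁ :* s′)) refl r c′ s′ p′ p₁ lam c₁)
      (trans (cong (λ z → z * c′ + (s′ * (p′ + p₁) + lam * c₁ * s′)) (trans (sym λs≡) (cong (lam *_) s≡)))
      (solve 6 (λ c′ s′ p′ p₁ l c₁ → l :* (s′ :+ c₁) :* c′ :+ (s′ :* (p′ :+ p₁) :+ l :* c₁ :* s′)
        := s′ :* p′ :+ (s′ :* (l :* (c′ :+ c₁)) :+ (l :* c₁ :* c′ :+ p₁ :* s′))) refl c′ s′ p′ p₁ lam c₁))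

  pow pow-1 : ℕ → Carrier
  pow   ℓ = ℕ→F (2 ^ ℓ)
  pow-1 ℓ = ℕ→F (2 ^ ℓ ∸ 1)

  pow≡1+ : ∀ ℓ → pow ℓ ≡ 1# + pow-1 ℓ
  pow≡1+ ℓ = cong ℕ→F (sym (ℕP.m+[n∸m]≡n (ℕP.m^n>0 2 ℓ)))

  pow-suc : ∀ ℓ → pow (suc ℓ) ≡ pow ℓ + pow ℓ
  pow-suc ℓ = trans (cong (λ z → ℕ→F (2 ^ ℓ ℕ.+ z)) (ℕP.+-identityʳ (2 ^ ℓ))) (ℕ→F-+ (2 ^ ℓ) (2 ^ ℓ))

  pow-1-suc : ∀ ℓ → pow-1 (suc ℓ) ≡ 1# + (pow-1 ℓ + pow-1 ℓ)
  -- Applied to `1# ≤ 1#`, `≤-via` cancels the common summand; both directions together give the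
  -- equality.
  pow-1-suc ℓ = antisym (≤-via ≤-refl eq) (≤-via ≤-refl (sym eq))
    where
    eq : pow-1 (suc ℓ) + 1# ≡ 1# + (pow-1 ℓ + pow-1 ℓ) + 1#
    eq = trans (+-comm _ 1#) (trans (sym (pow≡1+ (suc ℓ))) (trans (pow-suc ℓ)
      (trans (cong₂ _+_ (pow≡1+ ℓ) (pow≡1+ ℓ))
        (solve 1 (λ a → con 1 :+ a :+ (con 1 :+ a) := con 1 :+ (a :+ a) :+ con 1) refl (pow-1 ℓ)))))

  pow-1≤pow : ∀ ℓ → pow-1 ℓ ≤ pow ℓ
  pow-1≤pow ℓ = subst (pow-1 ℓ ≤_) (sym (pow≡1+ ℓ)) (y≤x+y 0≤1)

  2#⁻¹ : Carrier
  2#⁻¹ = (1# + 1#) ⁻¹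

  2≰0 : ¬ 1# + 1# ≤ 0#
  2≰0 le = 1≰0 (≤-trans (x≤x+y 0≤1) le)

  half+half : ∀ s → s * 2#⁻¹ + s * 2#⁻¹ ≡ s
  half+half s = trans (solve 2 (λ s h → s :* h :+ s :* h := s :* ((con 1 :+ con 1) :* h)) refl s 2#⁻¹)
    (trans (cong (s *_) (⁻¹-inverse _ (≰0⇒≢0 2≰0))) (*-identityʳ s))

  -- The halving step in a form fit for `≤-via`. With `x = lam * s`, the bounds
  -- `(2^ℓ - 1) r ≤ 2^ℓ V` for the remainder, used twice, and `x ≤ 2 p₁` for the first piece leave
  -- `(2^(ℓ+1) - 1) x ≤ 2^(ℓ+1) (p₁ + V)`.
  doubling : ∀ ℓ {x p₁ r V} → x ≡ p₁ + r →
    pow-1 (suc ℓ) * x + (pow ℓ * V + pow ℓ * V + (p₁ + p₁)) ≡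
    pow (suc ℓ) * (p₁ + V) + (pow-1 ℓ * r + pow-1 ℓ * r + x)
  doubling ℓ {_} {p₁} {r} {V} refl = subst₂ (λ N′ M′ →
      M′ * (p₁ + r) + (pow ℓ * V + pow ℓ * V + (p₁ + p₁)) ≡ N′ * (p₁ + V) + (M * r + M * r + (p₁ + r)))
    (sym (pow-suc ℓ)) (sym (pow-1-suc ℓ))
    (subst (λ N → (1# + (M + M)) * (p₁ + r) + (N * V + N * V + (p₁ + p₁)) ≡
                  (N + N) * (p₁ + V) + (M * r + M * r + (p₁ + r))) (sym (pow≡1+ ℓ))
      (solve 4 (λ M p₁ r V →
          (con 1 :+ (M :+ M)) :* (p₁ :+ r) :+ ((con 1 :+ M) :* V :+ (con 1 :+ M) :* V :+ (p₁ :+ p₁))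
          := (con 1 :+ M :+ (con 1 :+ M)) :* (p₁ :+ V) :+ (M :* r :+ M :* r :+ (p₁ :+ r)))
          refl M p₁ r V))
    where
    M = pow-1 ℓ

  FirstPiece : (Fin n → Carrier) → (Fin m → Carrier) → Carrier → Carrier → Tree → Set
  FirstPiece p c lam s t = Σ[ u ∈ Tree ] Valid src tgt u × u ⊑ t ×
    lam * s ≤ prizeOf p u + prizeOf p u × lam * costOf c u ≤ prizeOf p u × costOf c u ≤ s

  -- `extract` at threshold `s / 2`: half of the target `lam * s` is secured, while the cost may use
  -- up to all of `s`.
  first-piece : ∀ {p c lam s t} → (∀ v → 0# ≤ p v) → (∀ e → 0# ≤ c e) → 0# ≤ lam → 0# ≤ s →
    Valid src tgt t → lam * costOf c t ≤ prizeOf p t → lam * s ≤ prizeOf p t →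
    FirstPiece p c lam s t
  first-piece {p} {c} {lam} {s} {t} 0≤p 0≤c 0≤λ 0≤s vt λC≤P λs≤P
    with DensePiece.extract src tgt p 0≤p c 0≤c lam (s * 2#⁻¹) 0≤λ 0≤h t [] vt [] [] (λh≤P , λC≤P)
    where
    0≤h : 0# ≤ s * 2#⁻¹
    0≤h = *-nonneg 0≤s (⁻¹-nonneg 2≰0)
    λh≤P : lam * (s * 2#⁻¹) ≤ prizeOf p t
    λh≤P = ≤-trans (*-monoˡ-≤ lam 0≤λ (subst (s * 2#⁻¹ ≤_) (half+half s) (x≤x+y 0≤h))) λs≤P
  ... | u , vu , u⊑t , (λh≤pu , λcu≤pu) , cu≤2h = u , vu , u⊑t ,
    subst (_≤ prizeOf p u + prizeOf p u)
      (trans (sym (distribˡ lam (s * 2#⁻¹) (s * 2#⁻¹))) (cong (lam *_) (half+half s))) (+-mono λh≤pu λh≤pu) ,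
    λcu≤pu , subst (costOf c u ≤_) (half+half s) cu≤2h

  coverE-++≤ : ∀ {c k} u xs → (∀ e → 0# ≤ c e) → coverE (off inj₂ (items u) c) xs ≤ k →
               coverE c (items u ++ xs) ≤ costOf c u + k
  coverE-++≤ {c} u xs 0≤c le = ≤-trans (≤-reflexive (cover-++ inj₂ c (items u) xs))
    (+-mono (coverE≤total 0≤c (items u)) le)

  coverV-++≥ : ∀ {p} u xs → Unique (items u) →
               prizeOf p u + coverV (off inj₁ (items u) p) xs ≤ coverV p (items u ++ xs)
  coverV-++≥ {p} u xs unique = ≤-trans (+-mono (total≤coverV p unique) ≤-refl)
    (≤-reflexive (sym (cover-++ inj₁ p (items u) xs)))

  -- The prize bound is `(1 - 2^(-ℓ)) lam * s` with denominators cleared. Both bounds concern the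
  -- union of the pieces, which may overlap.
  PiecesFor : ℕ → (Fin n → Carrier) → (Fin m → Carrier) → Carrier → Carrier → Set
  PiecesFor ℓ p c lam s = Σ[ ts ∈ List Tree ] All (Valid src tgt) ts × length ts ℕ.≤ ℓ ×
    coverE c (concatMap items ts) ≤ s ×
    pow-1 ℓ * (lam * s) ≤ pow ℓ * coverV p (concatMap items ts)

  one-piece : ∀ ℓ {p c lam s} u → (∀ e → 0# ≤ c e) → 0# ≤ lam → 0# ≤ s → Valid src tgt u →
    Unique (items u) → costOf c u ≤ s → lam * s ≤ prizeOf p u → PiecesFor (suc ℓ) p c lam s
  one-piece ℓ {p} {c} {lam} {s} u 0≤c 0≤λ 0≤s vu unique cu≤s λs≤pu = [ u ] , vu ∷ [] , s≤s z≤n ,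
    ≤-trans (coverE-++≤ u [] 0≤c (≤-reflexive (sumF-0 m))) (≤-trans (≤-reflexive (+-identityʳ _)) cu≤s) ,
    ≤-trans (*-monoʳ-≤ (lam * s) (*-nonneg 0≤λ 0≤s) (pow-1≤pow (suc ℓ)))
      (*-monoˡ-≤ (pow (suc ℓ)) (ℕ→F-nonneg (2 ^ suc ℓ))
        (≤-trans λs≤pu (≤-trans (x≤x+y (≤-reflexive (sym (sumF-0 n)))) (coverV-++≥ u [] unique))))

  add-piece : ∀ ℓ {p c lam s lam′ s′ r} u → (∀ e → 0# ≤ c e) → Valid src tgt u → Unique (items u) →
    lam * s ≤ prizeOf p u + prizeOf p u → s ≡ s′ + costOf c u → lam * s ≡ prizeOf p u + r →
    lam′ * s′ ≡ r →
    PiecesFor ℓ (off inj₁ (items u) p) (off inj₂ (items u) c) lam′ s′ → PiecesFor (suc ℓ) p c lam s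
  add-piece ℓ {p} {c} {lam} {s} {lam′} {s′} {r} u 0≤c vu unique λs≤2pu s≡ λs≡ λ′s′≡r
    (ts , vts , len , cheap , rich) = u ∷ ts , vu ∷ vts , s≤s len ,
      ≤-trans (coverE-++≤ u (concatMap items ts) 0≤c cheap)
        (≤-reflexive (trans (+-comm (costOf c u) s′) (sym s≡))) ,
      ≤-trans (≤-via (+-mono (+-mono rich′ rich′) λs≤2pu) (doubling ℓ λs≡))
        (*-monoˡ-≤ (pow (suc ℓ)) (ℕ→F-nonneg (2 ^ suc ℓ)) (coverV-++≥ u (concatMap items ts) unique))
    where
    rich′ : pow-1 ℓ * r ≤ pow ℓ * coverV (off inj₁ (items u) p) (concatMap items ts)
    rich′ = subst (λ z → pow-1 ℓ * z ≤ _) λ′s′≡r rich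

  -- Induction on `ℓ` with the same tree throughout. Weights, budget and target shrink, the latter
  -- two to `s′ = s - c(u)` and `r = lam * s - p(u)`, and the new density is `r / s′`. As `u` brings
  -- at least half of the target, each piece halves what is missing.
  dense-pieces : ∀ ℓ {p c lam s t} → (∀ v → 0# ≤ p v) → (∀ e → 0# ≤ c e) → 0# ≤ lam → 0# ≤ s →
    Valid src tgt t → Unique (items t) →
    lam * costOf c t ≤ prizeOf p t → lam * s ≤ prizeOf p t → PiecesFor ℓ p c lam s
  -- `2^0 ∸ 1` is zero, so no prize is demanded of the empty list.
  dense-pieces zero 0≤p 0≤c 0≤λ 0≤s _ _ _ _ =
    [] , [] , z≤n ,
    ≤-trans (≤-reflexive (sumF-0 m)) 0≤s ,
    ≤-trans (≤-reflexive (zeroˡ _)) (*-nonneg (ℕ→F-nonneg 1) (≤-reflexive (sym (sumF-0 n))))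
  dense-pieces (suc ℓ) {p} {c} {lam} {s} {t} 0≤p 0≤c 0≤λ 0≤s vt unique λC≤P λs≤P =
    continue (first-piece 0≤p 0≤c 0≤λ 0≤s vt λC≤P λs≤P)
    where
    continue : FirstPiece p c lam s t → PiecesFor (suc ℓ) p c lam s
    -- A piece worth the whole target ends the iteration. Otherwise `lam * c(u) ≤ p(u) < lam * s`
    -- forces `c(u) < s`, so dividing by `s′` is legitimate.
    continue (u , vu , u⊑t , λs≤2pu , λcu≤pu , cu≤s) with (lam * s) ≤? prizeOf p u
    ... | yes λs≤pu = one-piece ℓ u 0≤c 0≤λ 0≤s vu (Unique-⊑ u⊑t unique) cu≤s λs≤pu
    ... | no λs≰pu = add-piece ℓ u 0≤c vu (Unique-⊑ u⊑t unique) λs≤2pu s≡ λs≡ λ′s′≡r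
        (dense-pieces ℓ {t = t} (off-nonneg inj₁ (items u) 0≤p) (off-nonneg inj₂ (items u) 0≤c)
          (*-nonneg 0≤r (⁻¹-nonneg s′≰0)) (≰⇒≥ s′≰0) vt unique λ′C′≤P′
          (≤-trans (≤-reflexive λ′s′≡r) r≤P′))
      where
      s′ r lam′ : Carrier
      s′ = s + - costOf c u
      r  = lam * s + - prizeOf p u
      lam′ = r * s′ ⁻¹
      s≡ : s ≡ s′ + costOf c u
      s≡ = sym (x-y+y s (costOf c u))
      λs≡ : lam * s ≡ prizeOf p u + r
      λs≡ = trans (sym (x-y+y (lam * s) (prizeOf p u))) (+-comm r _)
      s′≰0 : ¬ s′ ≤ 0#
      s′≰0 s′≤0 = λs≰pu (≤-trans (*-monoˡ-≤ lam 0≤λ s≤cu) λcu≤pu)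
        where
        s≤cu : s ≤ costOf c u
        s≤cu = subst₂ _≤_ (sym s≡) (+-identityˡ _) (+-mono s′≤0 ≤-refl)
      0≤r : 0# ≤ r
      0≤r = +-cancelʳ-≤ (prizeOf p u) (subst₂ _≤_ (sym (+-identityˡ _)) (sym (x-y+y (lam * s) _)) (≰⇒≥ λs≰pu))
      s′λ′≡r : s′ * lam′ ≡ r
      s′λ′≡r = trans (solve 3 (λ s r i → s :* (r :* i) := r :* (s :* i)) refl s′ r (s′ ⁻¹))
        (trans (cong (r *_) (⁻¹-inverse s′ (≰0⇒≢0 s′≰0))) (*-identityʳ r))
      λ′s′≡r : lam′ * s′ ≡ r
      λ′s′≡r = trans (*-comm lam′ s′) s′λ′≡r
      P′ C′ : Carrier
      P′ = prizeOf (off inj₁ (items u) p) t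
      C′ = costOf (off inj₂ (items u) c) t
      P≤ : prizeOf p t ≤ P′ + prizeOf p u
      P≤ = prize-off 0≤p u⊑t unique
      r≤P′ : r ≤ P′
      r≤P′ = +-cancelʳ-≤ (prizeOf p u) (≤-trans (≤-reflexive (x-y+y (lam * s) _)) (≤-trans λs≤P P≤))
      λ′C′≤P′ : lam′ * C′ ≤ P′
      λ′C′≤P′ = *-cancelˡ-≤ s′ s′≰0 (subst (_≤ s′ * P′)
        (trans (cong (_* C′) (sym s′λ′≡r)) (*-assoc s′ lam′ C′))
        (residual-dense 0≤λ 0≤r (≰⇒≥ s′≰0) (≤-trans 0≤r r≤P′) λs≡ s≡ λcu≤pu λC≤P λs≤P P≤
          (cost-off 0≤c u⊑t)))

-- Reachability, deletion of cycles and spanning trees in the graph.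

∨-true⁻ : ∀ a {b} → a ∨ b ≡ true → a ≡ true ⊎ b ≡ true
∨-true⁻ true  _  = inj₁ refl
∨-true⁻ false eq = inj₂ eq

∨-trueˡ : ∀ {a b} → a ≡ true → a ∨ b ≡ true
∨-trueˡ refl = refl

∨-trueʳ : ∀ a {b} → b ≡ true → a ∨ b ≡ true
∨-trueʳ true  _  = refl
∨-trueʳ false eq = eq

∧-true⁻ : ∀ a {b} → a ∧ b ≡ true → a ≡ true × b ≡ true
∧-true⁻ true eq = refl , eq

⌊⌋-true⁻ : {P : Set} (d : Dec P) → ⌊ d ⌋ ≡ true → P
⌊⌋-true⁻ (yes p) _ = p

⌊⌋-true⁺ : {P : Set} (d : Dec P) → P → ⌊ d ⌋ ≡ true
⌊⌋-true⁺ (yes _) _ = refl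
⌊⌋-true⁺ (no ¬p) p = contradiction p ¬p

anyF-true⁺ : ∀ {k} (f : Fin k → Bool) i → f i ≡ true → anyF f ≡ true
anyF-true⁺ f zero    eq = ∨-trueˡ eq
anyF-true⁺ f (suc i) eq = ∨-trueʳ (f zero) (anyF-true⁺ (f ∘ suc) i eq)

anyF-true⁻ : ∀ {k} (f : Fin k → Bool) → anyF f ≡ true → ∃[ i ] f i ≡ true
anyF-true⁻ {suc k} f eq with ∨-true⁻ (f zero) eq
... | inj₁ eq₀ = zero , eq₀
... | inj₂ eq₁ = let i , eqᵢ = anyF-true⁻ (f ∘ suc) eq₁ in suc i , eqᵢ

module Graph (F : OrderedField) {n m : ℕ} (I : Theory.Instance F n m) where
  open Theory F using (module Inst)
  open OrderedField F
  open OrderedFieldProperties F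
  open Inst I
  open Pieces F src tgt
  open DecMembership _≟ᵢ_ using (_∈?_)

  Endpoint : Edge → Fin n → Set
  Endpoint e v = src e ≡ v ⊎ tgt e ≡ v

  inV-root : ∀ S → inV S root ≡ true
  inV-root S = ∨-trueˡ (⌊⌋-true⁺ (root Fin.≟ root) refl)

  inV-endpoint : ∀ {S e v} → S e ≡ true → Endpoint e v → inV S v ≡ true
  inV-endpoint {S} {e} {v} Se end = ∨-trueʳ ⌊ v Fin.≟ root ⌋ (anyF-true⁺ _ e (trans (cong (_∧ _) Se) (touches end)))
    where
    touches : Endpoint e v → ⌊ src e Fin.≟ v ⌋ ∨ ⌊ tgt e Fin.≟ v ⌋ ≡ true
    touches (inj₁ eq) = ∨-trueˡ (⌊⌋-true⁺ (src e Fin.≟ v) eq)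
    touches (inj₂ eq) = ∨-trueʳ ⌊ src e Fin.≟ v ⌋ (⌊⌋-true⁺ (tgt e Fin.≟ v) eq)

  inV⁻ : ∀ {S v} → inV S v ≡ true → v ≡ root ⊎ (∃[ e ] (S e ≡ true × Endpoint e v))
  inV⁻ {S} {v} eq with ∨-true⁻ ⌊ v Fin.≟ root ⌋ eq
  ... | inj₁ v≡root = inj₁ (⌊⌋-true⁻ (v Fin.≟ root) v≡root)
  ... | inj₂ some with anyF-true⁻ _ some
  ...   | e , both with ∧-true⁻ (S e) both
  ...     | Se , end with ∨-true⁻ ⌊ src e Fin.≟ v ⌋ end
  ...       | inj₁ s = inj₂ (e , Se , inj₁ (⌊⌋-true⁻ (src e Fin.≟ v) s))
  ...       | inj₂ t = inj₂ (e , Se , inj₂ (⌊⌋-true⁻ (tgt e Fin.≟ v) t))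

  inV-mono : ∀ {S T v} → S ⊆ T → inV S v ≡ true → inV T v ≡ true
  inV-mono {S} {T} S⊆T v∈S with inV⁻ {S} v∈S
  ... | inj₁ refl         = inV-root T
  ... | inj₂ (e , Se , end) = inV-endpoint (S⊆T e Se) end

  Reach-refl : ∀ {S v} → Reach S v v
  Reach-refl = [] , [] , []

  Reach-trans : ∀ {S u v w} → Reach S u v → Reach S v w → Reach S u w
  Reach-trans (_ , [] , []) r = r
  Reach-trans (e ∷ es , fwd eq walk , Se ∷ Ses) r =
    let es′ , walk′ , S′ = Reach-trans (es , walk , Ses) r in e ∷ es′ , fwd eq walk′ , Se ∷ S′
  Reach-trans (e ∷ es , bwd eq walk , Se ∷ Ses) r =
    let es′ , walk′ , S′ = Reach-trans (es , walk , Ses) r in e ∷ es′ , bwd eq walk′ , Se ∷ S′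

  Reach-edge : ∀ {S e u v} → S e ≡ true → Joins src tgt e u v → Reach S u v
  Reach-edge {e = e} Se (inj₁ (refl , refl)) = [ e ] , fwd refl [] , Se ∷ []
  Reach-edge {e = e} Se (inj₂ (refl , refl)) = [ e ] , bwd refl [] , Se ∷ []

  Reach-sym : ∀ {S u v} → Reach S u v → Reach S v u
  Reach-sym (_ , [] , []) = Reach-refl
  Reach-sym (e ∷ es , fwd eq walk , Se ∷ Ses) =
    Reach-trans (Reach-sym (es , walk , Ses)) (Reach-edge Se (inj₂ (eq , refl)))
  Reach-sym (e ∷ es , bwd eq walk , Se ∷ Ses) =
    Reach-trans (Reach-sym (es , walk , Ses)) (Reach-edge Se (inj₁ (refl , eq)))

  Reach-mono : ∀ {S T u v} → S ⊆ T → Reach S u v → Reach T u v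
  Reach-mono S⊆T (w , walk , Sw) = w , walk , All.map (S⊆T _) Sw

  Reach-inV : ∀ {S u v} → inV S u ≡ true → Reach S u v → inV S v ≡ true
  Reach-inV u∈S (_ , [] , []) = u∈S
  Reach-inV u∈S (e ∷ es , fwd eq walk , Se ∷ Ses) = Reach-inV (inV-endpoint Se (inj₂ refl)) (es , walk , Ses)
  Reach-inV u∈S (e ∷ es , bwd eq walk , Se ∷ Ses) = Reach-inV (inV-endpoint Se (inj₁ refl)) (es , walk , Ses)

  without-⊆ : ∀ S e → (S without e) ⊆ S
  without-⊆ S e e′ eq = proj₁ (∧-true⁻ (S e′) eq)

  without-mono : ∀ {S T} e → S ⊆ T → (S without e) ⊆ (T without e)
  without-mono {S} e S⊆T e′ eq with ∧-true⁻ (S e′) eq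
  ... | Se′ , e≢e′ rewrite S⊆T e′ Se′ = e≢e′

  without-self : ∀ S e → (S without e) e ≢ true
  without-self S e eq with proj₂ (∧-true⁻ (S e) eq)
  ... | e≢e with e Fin.≟ e
  without-self S e eq | () | yes _
  ... | no e≢e′ = e≢e′ refl

  Reach-edge-avoid : ∀ {S e e′ u v} → Reach (S without e) (src e) (tgt e) →
                     S e′ ≡ true → Joins src tgt e′ u v → Reach (S without e) u v
  Reach-edge-avoid {S} {e} {e′} detour Se′ j with e Fin.≟ e′ in e≟e′
  Reach-edge-avoid detour Se′ (inj₁ (refl , refl)) | yes refl = detour
  Reach-edge-avoid detour Se′ (inj₂ (refl , refl)) | yes refl = Reach-sym detour
  Reach-edge-avoid {S} {e} {e′} detour Se′ j | no e≢e′ = Reach-edge kept j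
    where
    kept : (S without e) e′ ≡ true
    kept rewrite Se′ | e≟e′ = refl

  -- Every use of `e` on a walk is rerouted along the detour, so deleting an edge that is not a
  -- bridge loses no reachability.
  Reach-avoid : ∀ {S e u v} → Reach (S without e) (src e) (tgt e) → Reach S u v → Reach (S without e) u v
  Reach-avoid detour (_ , [] , []) = Reach-refl
  Reach-avoid detour (_ ∷ es , fwd eq walk , Se ∷ Ses) =
    Reach-trans (Reach-edge-avoid detour Se (inj₁ (eq , refl))) (Reach-avoid detour (es , walk , Ses))
  Reach-avoid detour (_ ∷ es , bwd eq walk , Se ∷ Ses) =
    Reach-trans (Reach-edge-avoid detour Se (inj₂ (refl , eq))) (Reach-avoid detour (es , walk , Ses))

  BridgesIn : List Edge → ESet → Set
  BridgesIn es S = All (λ e → S e ≡ true → ¬ Reach (S without e) (src e) (tgt e)) es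

  -- Reachability is not decided here, so the acyclic subset is only obtained
  -- under a double negation.
  delete-cycles : ∀ es S → Connected S →
    (∀ S′ → S′ ⊆ S → Connected S′ → (∀ v → Reach S root v → Reach S′ root v) → BridgesIn es S′ → ⊥) → ⊥
  delete-cycles [] S conn k = k S (λ _ Se → Se) conn (λ _ r → r) []
  delete-cycles (e ∷ es) S conn k = delete-cycles es S conn λ S′ S′⊆S conn′ reach bridges →
    k S′ S′⊆S conn′ reach ((λ S′e detour →
      delete-cycles es (S without e)
        (λ v v∈ → Reach-avoid (Reach-mono (without-mono e S′⊆S) detour) (conn v (inV-mono (without-⊆ S e) v∈)))
        λ S″ S″⊆ conn″ reach″ bridges″ →
          k S″ (λ e′ → without-⊆ S e e′ ∘ S″⊆ e′) conn″
            (λ v r → reach″ v (Reach-avoid (Reach-mono (without-mono e S′⊆S) detour) r))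
            ((λ S″e → contradiction (S″⊆ e S″e) (without-self S e)) ∷ bridges″)) ∷ bridges)

  spanning-subtree : ∀ {S} → Connected S →
    (∀ S′ → S′ ⊆ S → RootedSubtree S′ → (∀ v → Reach S root v → Reach S′ root v) → ⊥) → ⊥
  spanning-subtree {S} conn k = delete-cycles (allFin m) S conn λ S′ S′⊆S conn′ reach bridges →
    k S′ S′⊆S (conn′ , (λ e → All.lookup bridges (∈-allFin e))) reach

  tree-reach : ∀ {S t v} → Valid src tgt t → (∀ e → inj₂ e ∈ items t → S e ≡ true) →
               inj₁ v ∈ items t → Reach S (treeRoot t) v
  tree-reach {t = leaf _} _ _ (here refl) = Reach-refl
  tree-reach {t = graft t e s} (j , vt , vs) sub (there v∈) with ∈-++⁻ (items t) v∈
  ... | inj₁ v∈t = tree-reach vt (λ e′ → sub e′ ∘ there ∘ ∈-++⁺ˡ) v∈t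
  ... | inj₂ v∈s = Reach-trans (Reach-edge (sub e (here refl)) j)
                     (tree-reach vs (λ e′ → sub e′ ∘ there ∘ ∈-++⁺ʳ (items t)) v∈s)

  root∈items : ∀ t → inj₁ (treeRoot t) ∈ items t
  root∈items (leaf _)      = here refl
  root∈items (graft t _ _) = there (∈-++⁺ˡ (root∈items t))

  endpoints∈items : ∀ {t e v} → Valid src tgt t → inj₂ e ∈ items t → Endpoint e v → inj₁ v ∈ items t
  endpoints∈items {leaf _} _ (here ()) _
  endpoints∈items {leaf _} _ (there ()) _
  endpoints∈items {graft t e s} (j , _ , _) (here refl) end = there (ends j end)
    where
    ends : ∀ {v} → Joins src tgt e (treeRoot t) (treeRoot s) → Endpoint e v → inj₁ v ∈ items t ++ items s
    ends (inj₁ (eq , _)) (inj₁ refl) rewrite eq = ∈-++⁺ˡ (root∈items t)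
    ends (inj₁ (_ , eq)) (inj₂ refl) rewrite eq = ∈-++⁺ʳ (items t) (root∈items s)
    ends (inj₂ (eq , _)) (inj₁ refl) rewrite eq = ∈-++⁺ʳ (items t) (root∈items s)
    ends (inj₂ (_ , eq)) (inj₂ refl) rewrite eq = ∈-++⁺ˡ (root∈items t)
  endpoints∈items {graft t _ s} (_ , vt , vs) (there e∈) end with ∈-++⁻ (items t) e∈
  ... | inj₁ e∈t = there (∈-++⁺ˡ (endpoints∈items vt e∈t end))
  ... | inj₂ e∈s = there (∈-++⁺ʳ (items t) (endpoints∈items vs e∈s end))

  insert-leaf : ∀ {t a e b} → Valid src tgt t → inj₁ a ∈ items t → Joins src tgt e a b →
    ∃[ t′ ] (Valid src tgt t′ × treeRoot t′ ≡ treeRoot t × items t′ ↭ inj₁ b ∷ inj₂ e ∷ items t)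
  -- Every vertex sits at a leaf of the encoding, so `b` enters by replacing the leaf `a`. The root
  -- of this subtree is still `a`, which keeps all grafts above it valid.
  insert-leaf {leaf a} {e = e} {b} _ (here refl) j =
    graft (leaf a) e (leaf b) , (j , _ , _) , refl , shift (inj₁ b) (inj₂ e ∷ inj₁ a ∷ []) []
  insert-leaf {graft t e₀ s} {a} {e} {b} (j₀ , vt , vs) (there a∈) j with ∈-++⁻ (items t) a∈
  ... | inj₁ a∈t with insert-leaf vt a∈t j
  ...   | t′ , vt′ , root≡ , perm = graft t′ e₀ s ,
          (subst (λ r → Joins src tgt e₀ r (treeRoot s)) (sym root≡) j₀ , vt′ , vs) , root≡ ,
          ↭-trans (prep _ (++⁺ʳ (items s) perm)) (shift-two (items t ++ items s))
    where
    shift-two : ∀ xs → inj₂ e₀ ∷ inj₁ b ∷ inj₂ e ∷ xs ↭ inj₁ b ∷ inj₂ e ∷ inj₂ e₀ ∷ xs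
    shift-two xs = ↭-trans (swap _ _ ↭-refl) (prep _ (swap _ _ ↭-refl))
  insert-leaf {graft t e₀ s} {a} {e} {b} (j₀ , vt , vs) (there a∈) j | inj₂ a∈s with insert-leaf vs a∈s j
  ...   | s′ , vs′ , root≡ , perm = graft t e₀ s′ ,
          (subst (Joins src tgt e₀ (treeRoot t)) (sym root≡) j₀ , vt , vs′) , refl ,
          ↭-trans (prep _ (++⁺ˡ (items t) perm)) (shifts (inj₂ e₀ ∷ items t) (inj₁ b ∷ inj₂ e ∷ []))

  record GrownIn (S : ESet) (t : Tree) : Set where
    field
      valid  : Valid src tgt t
      rooted : treeRoot t ≡ root
      unique : Unique (items t)
      edges⊆ : ∀ e → inj₂ e ∈ items t → S e ≡ true

  _⊆ᵥ_ : Tree → Tree → Set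
  t ⊆ᵥ t′ = ∀ {v} → inj₁ v ∈ items t → inj₁ v ∈ items t′

  grow-edge : ∀ {S t a e b} → GrownIn S t → inj₁ a ∈ items t → S e ≡ true → Joins src tgt e a b →
              ∃[ t′ ] (GrownIn S t′ × t ⊆ᵥ t′ × inj₁ b ∈ items t′)
  grow-edge {S} {t} {a} {e} {b} g a∈t Se j with inj₁ b ∈? items t
  ... | yes b∈t = t , g , (λ v∈ → v∈) , b∈t
  ... | no  b∉t with insert-leaf (GrownIn.valid g) a∈t j
  ...   | t′ , vt′ , root≡ , perm = t′ , record
          { valid  = vt′
          ; rooted = trans root≡ (GrownIn.rooted g)
          ; unique = Unique-resp-↭ (↭-sym perm) ((((λ ()) ∷ All.¬Any⇒All¬ _ b∉t)) ∷ (All.¬Any⇒All¬ _ e∉t ∷ GrownIn.unique g))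
          ; edges⊆ = λ e′ e′∈ → in-S (∈-resp-↭ perm e′∈)
          } , (λ v∈ → ∈-resp-↭ (↭-sym perm) (there (there v∈))) , ∈-resp-↭ (↭-sym perm) (here refl)
    where
    end : Joins src tgt e a b → Endpoint e b
    end (inj₁ (_ , eq)) = inj₂ eq
    end (inj₂ (eq , _)) = inj₁ eq
    -- An edge of `t` has both endpoints in `t`; since `b` is new, so is `e`.
    e∉t : inj₂ e ∉ items t
    e∉t e∈t = b∉t (endpoints∈items (GrownIn.valid g) e∈t (end j))
    in-S : ∀ {e′} → inj₂ e′ ∈ inj₁ b ∷ inj₂ e ∷ items t → S e′ ≡ true
    in-S (there (here refl)) = Se
    in-S (there (there e′∈t))  = GrownIn.edges⊆ g _ e′∈t

  grow-walk : ∀ {S t u v} → GrownIn S t → inj₁ u ∈ items t → Reach S u v →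
              ∃[ t′ ] (GrownIn S t′ × t ⊆ᵥ t′ × inj₁ v ∈ items t′)
  grow-walk {t = t} g u∈t (_ , [] , []) = t , g , (λ v∈ → v∈) , u∈t
  grow-walk g u∈t (e ∷ es , fwd eq walk , Se ∷ Ses) =
    let t′ , g′ , t⊆t′ , b∈t′ = grow-edge g u∈t Se (inj₁ (eq , refl))
        t″ , g″ , t′⊆t″ , v∈t″ = grow-walk g′ b∈t′ (es , walk , Ses)
    in t″ , g″ , t′⊆t″ ∘ t⊆t′ , v∈t″
  grow-walk g u∈t (e ∷ es , bwd eq walk , Se ∷ Ses) =
    let t′ , g′ , t⊆t′ , b∈t′ = grow-edge g u∈t Se (inj₂ (refl , eq))
        t″ , g″ , t′⊆t″ , v∈t″ = grow-walk g′ b∈t′ (es , walk , Ses)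
    in t″ , g″ , t′⊆t″ ∘ t⊆t′ , v∈t″

  -- Each vertex is reached along its walk from the root. Edges leading to vertices already present
  -- are left out, so no item is ever repeated.
  grow-all : ∀ {S} → Connected S → (vs : List (Fin n)) →
             ∃[ t ] (GrownIn S t × (∀ {v} → v ∈ vs → inV S v ≡ true → inj₁ v ∈ items t))
  grow-all conn [] = leaf root , record
    { valid = _ ; rooted = refl ; unique = [] ∷ [] ; edges⊆ = λ { _ (here ()) ; _ (there ()) } } , λ ()
  grow-all {S} conn (u ∷ vs) with grow-all conn vs
  ... | t , g , spans with inV S u in u∈S?
  ...   | false = t , g , λ { (here refl) u∈S → contradiction (trans (sym u∈S) u∈S?) (λ ())
                            ; (there v∈vs) v∈S → spans v∈vs v∈S }
  ...   | true with grow-walk g (subst (λ r → inj₁ r ∈ items t) (GrownIn.rooted g) (root∈items t)) (conn u u∈S?)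
  ...     | t′ , g′ , t⊆t′ , u∈t′ = t′ , g′ , λ { (here refl) _ → u∈t′ ; (there v∈vs) v∈S → t⊆t′ (spans v∈vs v∈S) }

  spanning-tree : ∀ {S} → Connected S → ∃[ t ] (GrownIn S t × (∀ {v} → inV S v ≡ true → inj₁ v ∈ items t))
  spanning-tree conn = let t , g , spans = grow-all conn (allFin n) in t , g , spans (∈-allFin _)

-- Greedy runs, merging, and prefixes of the output.

module Phases (F : OrderedField) {n m : ℕ} (I : Theory.Instance F n m) where
  open Theory F using (module Inst)
  open OrderedField F
  open OrderedFieldProperties F
  open Inst I
  open Pieces F src tgt
  open DecMembership _≟ᵢ_ using (_∈?_)
  open Graph F I

  cost-nonneg : ∀ e → 0# ≤ cost e
  cost-nonneg e = proj₁ (cost-pos e)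

  toSet⁺ : ∀ {e L} → e ∈ L → toSet L e ≡ true
  toSet⁺ {e} (here refl) = ∨-trueˡ (⌊⌋-true⁺ (e Fin.≟ e) refl)
  toSet⁺ {e} {e′ ∷ L} (there e∈L) = ∨-trueʳ ⌊ e′ Fin.≟ e ⌋ (toSet⁺ e∈L)

  toSet⁻ : ∀ {e} L → toSet L e ≡ true → e ∈ L
  toSet⁻ {e} (e′ ∷ L) eq with ∨-true⁻ ⌊ e′ Fin.≟ e ⌋ eq
  ... | inj₁ e≡ = here (sym (⌊⌋-true⁻ (e′ Fin.≟ e) e≡))
  ... | inj₂ e∈ = there (toSet⁻ L e∈)

  toSet-mono : ∀ L {L′} → (∀ {e} → e ∈ L → e ∈ L′) → toSet L ⊆ toSet L′
  toSet-mono L sub e = toSet⁺ ∘ sub ∘ toSet⁻ L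

  walkCost-nonneg : ∀ L → 0# ≤ walkCost L
  walkCost-nonneg = total-of-nonneg cost cost-nonneg

  walkCost-items : ∀ L → total-of (costItem cost) (map inj₂ L) ≡ walkCost L
  walkCost-items []      = refl
  walkCost-items (e ∷ L) = cong (cost e +_) (walkCost-items L)

  costS-mono : ∀ {S T} → S ⊆ T → costS S ≤ costS T
  costS-mono {S} {T} S⊆T = sumF-mono pointwise
    where
    pointwise : ∀ e → (if S e then cost e else 0#) ≤ (if T e then cost e else 0#)
    pointwise e with S e in Se
    ... | true rewrite S⊆T e Se = ≤-refl
    ... | false with T e
    ...   | true  = cost-nonneg e
    ...   | false = ≤-refl

  costS-toSet : ∀ L → costS (toSet L) ≤ walkCost L
  costS-toSet L = ≤-trans (mono-cover inj₂ cost-nonneg (toSet L) (λ e → ∈-map⁺ inj₂ ∘ toSet⁻ L))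
    (≤-trans (coverE≤total cost-nonneg (map inj₂ L)) (≤-reflexive (walkCost-items L)))

  walkCost≤costS : ∀ {L S} → Unique L → (∀ {e} → e ∈ L → S e ≡ true) → walkCost L ≤ costS S
  walkCost≤costS {L} {S} unique sub = ≤-trans (≤-reflexive (sym (walkCost-items L)))
    (≤-trans (total≤coverE cost (Unique.map⁺ inj₂-injective unique)) (cover-mono inj₂ cost-nonneg S in-S))
    where
    in-S : ∀ e → inj₂ e ∈ map inj₂ L → S e ≡ true
    in-S e e∈ with ∈-map⁻ inj₂ e∈
    ... | _ , e∈L , refl = sub e∈L

  -- Restricted to positive prizes, because `Spans` and a vanishing residual guarantee nothing about
  -- the other vertices.
  prizeS-mono-positive : ∀ {S T} → (∀ v → inV S v ≡ true → ¬ prize v ≤ 0# → inV T v ≡ true) → prizeS S ≤ prizeS T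
  prizeS-mono-positive {S} {T} sub = sumF-mono pointwise
    where
    pointwise : ∀ v → (if inV S v then prize v else 0#) ≤ (if inV T v then prize v else 0#)
    pointwise v with inV S v in v∈S | inV T v in v∈T
    ... | true  | true  = ≤-refl
    ... | true  | false = decidable-stable (prize v ≤? 0#)
      λ pv≰0 → contradiction (trans (sym v∈T) (sub v v∈S pv≰0)) (λ ())
    ... | false | true  = prize-nonneg v
    ... | false | false = ≤-refl

  -- What merging needs to know about the order of a greedy run: each edge touches a vertex reached
  -- before.
  data AttachedTo : List Edge → List Edge → Set where
    []  : ∀ {Tb} → AttachedTo Tb []
    _∷_ : ∀ {Tb e es} → IncidentTo (toSet Tb) e → AttachedTo (Tb ++ [ e ]) es → AttachedTo Tb (e ∷ es)

  greedy-attached : ∀ {H Tb es} → GreedyFrom H Tb es → AttachedTo Tb es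
  greedy-attached (finish _)            = []
  greedy-attached (next _ _ _ _ inc gr) = inc ∷ greedy-attached gr

  greedy-residual : ∀ {H Tb es} → GreedyFrom H Tb es → residual H (toSet (Tb ++ es)) ≡ 0#
  greedy-residual {H} {Tb} (finish eq) = subst (λ L → residual H (toSet L) ≡ 0#) (sym (++-identityʳ Tb)) eq
  greedy-residual {H} {Tb} {e ∷ es} (next _ _ _ _ _ gr) =
    subst (λ L → residual H (toSet L) ≡ 0#) (++-assoc Tb [ e ] es) (greedy-residual gr)

  greedy-fresh : ∀ {H Tb es} → GreedyFrom H Tb es → ∀ {e} → e ∈ es → H e ≡ true × e ∉ Tb
  greedy-fresh {Tb = Tb} (next {e = e} _ S (((S⊆H , S∩Tb , _) , _) , _) Se _ gr) (here refl) =
    S⊆H e Se , λ e∈Tb → contradiction (trans (sym (toSet⁺ e∈Tb)) (S∩Tb e Se)) (λ ())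
  greedy-fresh (next _ _ _ _ _ gr) (there e∈) =
    let He , fresh = greedy-fresh gr e∈ in He , fresh ∘ ∈-++⁺ˡ

  greedy-unique : ∀ {H Tb es} → GreedyFrom H Tb es → Unique es
  greedy-unique (finish _) = []
  greedy-unique {Tb = Tb} (next {e = e} _ _ _ _ _ gr) =
    All.tabulate (λ e′∈ → λ { refl → proj₂ (greedy-fresh gr e′∈) (∈-++⁺ʳ Tb (here refl)) }) ∷ greedy-unique gr

  greedy-prize : ∀ {H π} → DensityGreedy H π → prizeS H ≤ prizeS (toSet π)
  greedy-prize {H} {π} gr = prizeS-mono-positive λ v v∈H pv≰0 → covered v v∈H pv≰0
    where
    covered : ∀ v → inV H v ≡ true → ¬ prize v ≤ 0# → inV (toSet π) v ≡ true
    covered v v∈H pv≰0 with inV (toSet π) v in v∉π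
    ... | true  = refl
    -- The residual is a sum of nonnegative terms, so its vanishing bounds the single term of `v`,
    -- which is its prize, by zero.
    ... | false = contradiction (subst (prize v ≤_) (greedy-residual gr)
        (subst (_≤ residual H (toSet π)) here-prize (term≤sumF term-nonneg v))) pv≰0
      where
      term : Fin n → Carrier
      term u = if inV H u ∧ not (inV (toSet π) u) then prize u else 0#
      term-nonneg : ∀ u → 0# ≤ term u
      term-nonneg u with inV H u ∧ not (inV (toSet π) u)
      ... | true  = prize-nonneg u
      ... | false = ≤-refl
      here-prize : term v ≡ prize v
      here-prize rewrite v∈H | v∉π = refl

  greedy-cost : ∀ {H π} → DensityGreedy H π → walkCost π ≤ costS H
  greedy-cost gr = walkCost≤costS (greedy-unique gr) (proj₁ ∘ greedy-fresh gr)

  SpannedBy : List Edge → List Edge → Set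
  SpannedBy L L′ = ∀ v → inV (toSet L) v ≡ true → inV (toSet L′) v ≡ true

  SpannedBy-snoc : ∀ {Tb e π} → SpannedBy Tb π → (∀ v → Endpoint e v → inV (toSet π) v ≡ true) → SpannedBy (Tb ++ [ e ]) π
  SpannedBy-snoc {Tb} {e} {π} cov ends v v∈ with inV⁻ {toSet (Tb ++ [ e ])} v∈
  ... | inj₁ refl = inV-root (toSet π)
  ... | inj₂ (e′ , e′∈ , end) with ∈-++⁻ Tb (toSet⁻ (Tb ++ [ e ]) e′∈)
  ...   | inj₁ e′∈Tb           = cov v (inV-endpoint (toSet⁺ e′∈Tb) end)
  ...   | inj₂ (here refl)   = ends v end

  -- A skipped edge adds no vertex. In the cycle case the walk may be empty, namely for a loop, so
  -- one endpoint has to be known to lie in `π`; the other is then reached through `π`.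
  Skip-endpoints : ∀ {π e} → Skip π e → IncidentTo (toSet π) e → ∀ v → Endpoint e v → inV (toSet π) v ≡ true
  Skip-endpoints (inj₁ e∈π) _ v end = inV-endpoint (toSet⁺ e∈π) end
  Skip-endpoints (inj₂ (inj₁ (e′ , e′∈π , inj₁ (s≡ , t≡)))) _ v (inj₁ end) = inV-endpoint (toSet⁺ e′∈π) (inj₁ (trans (sym s≡) end))
  Skip-endpoints (inj₂ (inj₁ (e′ , e′∈π , inj₁ (s≡ , t≡)))) _ v (inj₂ end) = inV-endpoint (toSet⁺ e′∈π) (inj₂ (trans (sym t≡) end))
  Skip-endpoints (inj₂ (inj₁ (e′ , e′∈π , inj₂ (s≡ , t≡)))) _ v (inj₁ end) = inV-endpoint (toSet⁺ e′∈π) (inj₂ (trans (sym s≡) end))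
  Skip-endpoints (inj₂ (inj₁ (e′ , e′∈π , inj₂ (s≡ , t≡)))) _ v (inj₂ end) = inV-endpoint (toSet⁺ e′∈π) (inj₁ (trans (sym t≡) end))
  Skip-endpoints (inj₂ (inj₂ cycle)) (inj₁ s∈) v (inj₁ refl) = s∈
  Skip-endpoints {π} (inj₂ (inj₂ cycle)) (inj₁ s∈) v (inj₂ refl) = Reach-inV {toSet π} s∈ cycle
  Skip-endpoints {π} (inj₂ (inj₂ cycle)) (inj₂ t∈) v (inj₁ refl) = Reach-inV {toSet π} t∈ (Reach-sym cycle)
  Skip-endpoints (inj₂ (inj₂ cycle)) (inj₂ t∈) v (inj₂ refl) = t∈

  -- Invariant: the part `Tb` of the new run that has been handled is spanned by the current `π`. An
  -- edge attached to `Tb` is therefore incident to `π` as well, which settles the skipped edges.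
  Merge-spans : ∀ {π es π′ Tb} → Merge π es π′ → SpannedBy Tb π → AttachedTo Tb es → SpannedBy (Tb ++ es) π′
  Merge-spans {π} {Tb = Tb} done cov [] = subst (λ L → SpannedBy L π) (sym (++-identityʳ Tb)) cov
  Merge-spans {π} {e ∷ es} {π′} {Tb} (skip sk mg) cov (inc ∷ att) =
    subst (λ L → SpannedBy L π′) (++-assoc Tb [ e ] es)
      (Merge-spans mg (SpannedBy-snoc {Tb} {e} {π} cov (Skip-endpoints sk ([ inj₁ ∘ cov _ , inj₂ ∘ cov _ ]′ inc))) att)
  Merge-spans {π} {e ∷ es} {π′} {Tb} (keep _ mg) cov (_ ∷ att) =
    subst (λ L → SpannedBy L π′) (++-assoc Tb [ e ] es)
      (Merge-spans mg (SpannedBy-snoc {Tb} {e} {π ++ [ e ]}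
        (λ v → inV-mono (toSet-mono π ∈-++⁺ˡ) ∘ cov v)
        (λ v → inV-endpoint {toSet (π ++ [ e ])} (toSet⁺ (∈-++⁺ʳ π (here refl))))) att)

  Merge-cost : ∀ {π es π′} → Merge π es π′ → walkCost π′ ≤ walkCost π + walkCost es
  Merge-cost {π} done = x≤x+y ≤-refl
  Merge-cost {π} {e ∷ es} (skip _ mg) = ≤-trans (Merge-cost mg) (+-mono ≤-refl (y≤x+y (cost-nonneg e)))
  Merge-cost {π} {e ∷ es} (keep _ mg) = ≤-trans (Merge-cost mg) (≤-reflexive
    (trans (cong (_+ walkCost es) (total-of-++ cost π))
      (solve 3 (λ a b c → a :+ (b :+ con 0) :+ c := a :+ (b :+ c)) refl (walkCost π) (cost e) (walkCost es))))

  Merge-extends : ∀ {π es π′} → Merge π es π′ → ∃[ ρ ] π′ ≡ π ++ ρ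
  Merge-extends {π} done = [] , sym (++-identityʳ π)
  Merge-extends (skip _ mg) = Merge-extends mg
  Merge-extends {π} {e ∷ _} (keep _ mg) = let ρ , eq = Merge-extends mg in
    e ∷ ρ , trans eq (++-assoc π [ e ] ρ)

  CS-extends : ∀ {χ i π out} → CS χ i π out → ∃[ ρ ] out ≡ π ++ ρ
  CS-extends {π = π} (stop _) = [] , sym (++-identityʳ π)
  CS-extends {π = π} (step _ _ _ _ mg cs) =
    let ρ , eq = Merge-extends mg ; σ , eq′ = CS-extends cs in
    ρ ++ σ , trans eq′ (trans (cong (_++ σ) eq) (++-assoc π ρ σ))

  phase-prize : ∀ {H πᵢ π π′} → DensityGreedy H πᵢ → Merge π πᵢ π′ → prizeS H ≤ prizeS (toSet π′)
  phase-prize {π = π} gr mg = ≤-trans (greedy-prize gr)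
    (prizeS-mono-positive λ v v∈ _ → Merge-spans {Tb = []} mg (λ v → inV-mono {toSet []} {toSet π} (λ _ ())) (greedy-attached gr) v v∈)

  -- `algEdges` tests running sums, so the fit of a prefix is spelled out for all its partial sums;
  -- by nonnegativity of the costs, the total is the strictest of these tests.
  data FitsFrom (B acc : Carrier) : List Edge → Set where
    []  : FitsFrom B acc []
    _∷_ : ∀ {e π} → acc + cost e ≤ B → FitsFrom B (acc + cost e) π → FitsFrom B acc (e ∷ π)

  fits : ∀ {B acc} π → acc + walkCost π ≤ B → FitsFrom B acc π
  fits []      _  = []
  fits {B} {acc} (e ∷ π) le = ≤-trans (x≤x+y (walkCost-nonneg π)) le′ ∷ fits π le′
    where
    le′ : acc + cost e + walkCost π ≤ B
    le′ = subst (_≤ B) (sym (+-assoc acc (cost e) (walkCost π))) le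

  -- The recursion inside algEdges has no name; abstracting 0# in the goal of
  -- the first lemma lets unification supply it in the type of the second.
  mutual
    algEdges-prefix : ∀ B π L ρ → L ≡ π ++ ρ → ∀ {e} → FitsFrom B 0# π → e ∈ π → e ∈ algEdges B L
    algEdges-prefix B π L ρ eq fs e∈π with 0# | fs
    ... | acc | fs′ = algEdges-prefix-from B π acc L ρ eq fs′ e∈π

    algEdges-prefix-from : ∀ B π acc L ρ → L ≡ π ++ ρ → ∀ {e} → FitsFrom B acc π → e ∈ π → e ∈ _
    algEdges-prefix-from B (e ∷ π) acc _ ρ refl (le ∷ fs) e∈ with (acc + cost e) ≤? B
    algEdges-prefix-from B (e ∷ π) acc _ ρ refl (le ∷ fs) (here refl) | yes _ = here refl
    algEdges-prefix-from B (e ∷ π) acc _ ρ refl (le ∷ fs) (there e∈π)   | yes _ =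
      there (algEdges-prefix-from B π (acc + cost e) (π ++ ρ) ρ refl fs e∈π)
    ... | no ¬le = contradiction le ¬le

  Alg-prefix : ∀ {D} π ρ → walkCost π ≤ D → prizeS (toSet π) ≤ prizeS (Alg D (π ++ ρ))
  Alg-prefix {D} π ρ le = prizeS-mono-positive λ v v∈ _ → inV-mono {toSet π}
    (toSet-mono π (algEdges-prefix D π (π ++ ρ) ρ refl (fits π (subst (_≤ D) (sym (+-identityˡ _)) le)))) v∈

-- Joining pieces to the root and comparing with the phases.

module Competitive (F : OrderedField) {n m : ℕ} (I : Theory.Instance F n m) where
  open Theory F using (module Inst)
  open OrderedField F
  open OrderedFieldProperties F
  open Inst I
  open Pieces F src tgt
  open DecMembership _≟ᵢ_ using (_∈?_)
  open Graph F I
  open Phases F I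

  pieces-reach : ∀ {S ts} → All (Valid src tgt) ts → All (λ t → Reach S root (treeRoot t)) ts →
    (∀ e → inj₂ e ∈ concatMap items ts → S e ≡ true) → ∀ {v} → inj₁ v ∈ concatMap items ts → Reach S root v
  pieces-reach {S} {t ∷ ts} (vt ∷ vts) (rt ∷ rts) sub v∈ with ∈-++⁻ (items t) v∈
  ... | inj₁ v∈t  = Reach-trans rt (tree-reach {S} vt (λ e → sub e ∘ ∈-++⁺ˡ) v∈t)
  ... | inj₂ v∈ts = pieces-reach {S} vts rts (λ e → sub e ∘ ∈-++⁺ʳ (items t)) v∈ts

  pieces-endpoints : ∀ {ts e v} → All (Valid src tgt) ts → inj₂ e ∈ concatMap items ts → Endpoint e v →
    inj₁ v ∈ concatMap items ts
  pieces-endpoints {t ∷ ts} (vt ∷ vts) e∈ end with ∈-++⁻ (items t) e∈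
  ... | inj₁ e∈t  = ∈-++⁺ˡ (endpoints∈items vt e∈t end)
  ... | inj₂ e∈ts = ∈-++⁺ʳ (items t) (pieces-endpoints vts e∈ts end)

  -- The second component reaches the intermediate vertices of the walk: `Connected` asks for every
  -- endpoint of a chosen edge.
  walk-reach : ∀ {S u v w} → Reach S root u → Walk u v w → (∀ {e} → e ∈ w → S e ≡ true) →
    Reach S root v × (∀ {e} → e ∈ w → Reach S root (src e))
  walk-reach r [] sub = r , λ ()
  walk-reach {S} r (fwd {e = e} refl walk) sub =
    let r′ , rs = walk-reach {S} (Reach-trans r (Reach-edge (sub (here refl)) (inj₁ (refl , refl)))) walk (sub ∘ there)
    in r′ , λ { (here refl) → r ; (there e∈) → rs e∈ }
  walk-reach {S} r (bwd {e = e} refl walk) sub =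
    let r-src = Reach-trans r (Reach-edge (sub (here refl)) (inj₂ (refl , refl)))
        r′ , rs = walk-reach {S} r-src walk (sub ∘ there)
    in r′ , λ { (here refl) → r-src ; (there e∈) → rs e∈ }

  module _ {χ : Carrier} (ecc : IsEccentricity χ) where

    χ-nonneg : 0# ≤ χ
    χ-nonneg = let _ , (w , _ , cost≡χ) , _ = proj₂ ecc in subst (0# ≤_) cost≡χ (walkCost-nonneg w)

    -- One minimum-cost walk from the root per piece, each bounded by the eccentricity; this is the
    -- source of the extra `ℓχ`.
    connectors : ∀ ts → Σ[ w ∈ List Edge ] (walkCost w ≤ ℕ→F (length ts) * χ ×
      (∀ S → (∀ {e} → e ∈ w → S e ≡ true) →
        All (λ t → Reach S root (treeRoot t)) ts × (∀ {e} → e ∈ w → Reach S root (src e))))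
    connectors [] = [] , ≤-reflexive (sym (zeroˡ χ)) , λ S sub → [] , λ ()
    connectors (t ∷ ts) with proj₁ ecc (treeRoot t) | connectors ts
    ... | d , ((w , walk , cost≡d) , _) , d≤χ | w′ , cheap , reach = w ++ w′ ,
        subst₂ _≤_ (sym (total-of-++ cost w)) (solve 2 (λ x k → x :+ k :* x := (con 1 :+ k) :* x) refl χ _)
          (+-mono (≤-trans (≤-reflexive cost≡d) d≤χ) cheap) ,
        λ S sub →
          let r , rs = walk-reach {S} Reach-refl walk (sub ∘ ∈-++⁺ˡ)
              rts , rs′ = reach S (sub ∘ ∈-++⁺ʳ w)
          in r ∷ rts , λ e∈ → [ rs , rs′ ]′ (∈-++⁻ w e∈)

    ConnectedUnion : List Tree → Set
    ConnectedUnion ts = Σ[ S ∈ ESet ] (Connected S ×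
      costS S ≤ coverE cost (concatMap items ts) + ℕ→F (length ts) * χ ×
      (∀ v → inj₁ v ∈ concatMap items ts → Reach S root v))

    connected-union : ∀ ts → All (Valid src tgt) ts → ConnectedUnion ts
    connected-union ts vts with connectors ts
    ... | w , cheap , reach = S , conn , cost≤ , λ v → reach-piece
      where
      U = concatMap items ts
      S : ESet
      S e = ⌊ inj₂ e ∈? U ⌋ ∨ toSet w e
      w⊆S : ∀ {e} → e ∈ w → S e ≡ true
      w⊆S {e} e∈w = ∨-trueʳ ⌊ inj₂ e ∈? U ⌋ (toSet⁺ e∈w)
      U⊆S : ∀ e → inj₂ e ∈ U → S e ≡ true
      U⊆S e e∈U = ∨-trueˡ (⌊⌋-true⁺ (inj₂ e ∈? U) e∈U)
      reach-piece : ∀ {v} → inj₁ v ∈ U → Reach S root v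
      reach-piece = pieces-reach {S} vts (proj₁ (reach S w⊆S)) U⊆S
      conn : Connected S
      conn v v∈S with inV⁻ {S} v∈S
      ... | inj₁ refl = Reach-refl
      ... | inj₂ (e , Se , end) with ∨-true⁻ ⌊ inj₂ e ∈? U ⌋ Se
      ...   | inj₁ e∈U = reach-piece (pieces-endpoints vts (⌊⌋-true⁻ (inj₂ e ∈? U) e∈U) end)
      ...   | inj₂ e∈w with proj₂ (reach S w⊆S) (toSet⁻ w e∈w) | end
      ...     | r | inj₁ refl = r
      ...     | r | inj₂ refl = Reach-trans r (Reach-edge Se (inj₁ (refl , refl)))
      cost≤ : costS S ≤ coverE cost U + ℕ→F (length ts) * χ
      cost≤ = ≤-trans (sumF-mono pointwise) (≤-trans (≤-reflexive (sumF-+ {m} _ _))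
        (+-mono ≤-refl (≤-trans (costS-toSet w) cheap)))
        where
        pointwise : ∀ e → (if S e then cost e else 0#) ≤
          (if ⌊ inj₂ e ∈? U ⌋ then cost e else 0#) + (if toSet w e then cost e else 0#)
        pointwise e with ⌊ inj₂ e ∈? U ⌋ | toSet w e
        ... | true  | true  = x≤x+y (cost-nonneg e)
        ... | true  | false = x≤x+y ≤-refl
        ... | false | true  = y≤x+y ≤-refl
        ... | false | false = x≤x+y ≤-refl

    four : Carrier → Carrier
    four x = x + x + (x + x)

    four-mono : ∀ {x y} → x ≤ y → four x ≤ four y
    four-mono le = +-mono (+-mono le le) (+-mono le le)

    four-cancel : ∀ {x y} → four x ≤ four y → x ≤ y
    four-cancel {x} {y} le with total x y
    ... | inj₁ x≤y = x≤y
    ... | inj₂ y≤x = ≤-via (+-mono le (+-mono y≤x (+-mono y≤x y≤x)))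
      (solve 2 (λ x y → x :+ (y :+ y :+ (y :+ y) :+ (x :+ (x :+ x))) := y :+ (x :+ x :+ (x :+ x) :+ (y :+ (y :+ y)))) refl x y)

    pow-suc-suc : ∀ i x → pow (suc (suc i)) * x ≡ four (pow i * x)
    pow-suc-suc i x = trans (cong (_* x) (trans (pow-suc (suc i)) (cong₂ _+_ (pow-suc i) (pow-suc i))))
      (solve 2 (λ p x → (p :+ p :+ (p :+ p)) :* x := p :* x :+ p :* x :+ (p :* x :+ p :* x)) refl (pow i) x)

    pow-1≤4pow : ∀ ℓ {x y} → 0# ≤ x → x ≤ y → pow-1 ℓ * x ≤ pow (suc (suc ℓ)) * y
    pow-1≤4pow ℓ {x} {y} 0≤x x≤y = ≤-trans (*-monoʳ-≤ x 0≤x (pow-1≤pow ℓ))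
      (≤-trans (*-monoˡ-≤ (pow ℓ) (ℕ→F-nonneg (2 ^ ℓ)) x≤y)
        (≤-trans (≤-trans (x≤x+y 0≤z) (x≤x+y (+-nonneg 0≤z 0≤z))) (≤-reflexive (sym (pow-suc-suc ℓ y)))))
      where
      0≤z : 0# ≤ pow ℓ * y
      0≤z = *-nonneg (ℕ→F-nonneg (2 ^ ℓ)) (≤-trans 0≤x x≤y)

    prizeS-nonneg : ∀ S → 0# ≤ prizeS S
    prizeS-nonneg S = sumF-nonneg term-nonneg
      where
      term-nonneg : ∀ v → 0# ≤ (if inV S v then prize v else 0#)
      term-nonneg v with inV S v
      ... | true  = prize-nonneg v
      ... | false = ≤-refl

    QuarterPieces : ℕ → ESet → Set
    QuarterPieces ℓ T = Σ[ ts ∈ List Tree ] All (Valid src tgt) ts × length ts ℕ.≤ ℓ ×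
      four (coverE cost (concatMap items ts)) ≤ costS T ×
      pow-1 ℓ * prizeS T ≤ pow (suc (suc ℓ)) * coverV prize (concatMap items ts)

    -- `dense-pieces` with `lam = P / C` and budget `q = C / 4`, where `C` is the cost of `T` and
    -- `P` the prize of a tree `t` spanning it. Since `lam * C = P`, both density hypotheses follow
    -- from `c(t) ≤ C` and `q ≤ C`, and the target `lam * q` is `P / 4`.
    quarter-pieces : ∀ ℓ {T} → Connected T → ¬ costS T ≤ 0# → QuarterPieces ℓ T
    quarter-pieces ℓ {T} conn C≰0 with spanning-tree conn
    ... | t , g , spans = assemble (dense-pieces ℓ {t = t} prize-nonneg cost-nonneg 0≤λ 0≤q
            (GrownIn.valid g) (GrownIn.unique g)
            (≤-trans (*-monoˡ-≤ lam 0≤λ c≤C) (≤-reflexive λC≡P)) (≤-trans (*-monoˡ-≤ lam 0≤λ q≤C) (≤-reflexive λC≡P)))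
      where
      C P lam q : Carrier
      C   = costS T
      P   = prizeOf prize t
      lam = P * C ⁻¹
      q   = C * 2#⁻¹ * 2#⁻¹
      0≤C : 0# ≤ C
      0≤C = ≰⇒≥ C≰0
      0≤P : 0# ≤ P
      0≤P = total-of-nonneg (prizeItem prize) (λ { (inj₁ v) → prize-nonneg v ; (inj₂ _) → ≤-refl }) (items t)
      0≤λ : 0# ≤ lam
      0≤λ = *-nonneg 0≤P (⁻¹-nonneg C≰0)
      0≤h : 0# ≤ C * 2#⁻¹
      0≤h = *-nonneg 0≤C (⁻¹-nonneg 2≰0)
      0≤q : 0# ≤ q
      0≤q = *-nonneg 0≤h (⁻¹-nonneg 2≰0)
      q≤C : q ≤ C
      q≤C = ≤-trans (subst (q ≤_) (half+half _) (x≤x+y 0≤q)) (subst (C * 2#⁻¹ ≤_) (half+half C) (x≤x+y 0≤h))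
      λC≡P : lam * C ≡ P
      λC≡P = trans (*-assoc P (C ⁻¹) C) (trans
        (cong (P *_) (trans (*-comm (C ⁻¹) C) (⁻¹-inverse C (≰0⇒≢0 C≰0)))) (*-identityʳ P))
      c≤C : costOf cost t ≤ C
      c≤C = ≤-trans (total≤coverE cost (GrownIn.unique g)) (cover-mono inj₂ cost-nonneg T (GrownIn.edges⊆ g))
      four-q : four q ≡ C
      four-q = trans (cong₂ _+_ (half+half _) (half+half _)) (half+half C)
      p≤P : prizeS T ≤ P
      p≤P = ≤-trans (mono-cover inj₁ prize-nonneg (inV T) (λ v → spans)) (coverV≤total prize-nonneg (items t))
      assemble : PiecesFor ℓ prize cost lam q → QuarterPieces ℓ T
      assemble (ts , vts , len , cheap , rich) = ts , vts , len ,
        ≤-trans (four-mono cheap) (≤-reflexive four-q) ,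
        ≤-trans (*-monoˡ-≤ (pow-1 ℓ) (ℕ→F-nonneg (2 ^ ℓ ∸ 1)) (≤-trans p≤P (≤-reflexive (sym λC≡P))))
          (≤-trans (≤-reflexive (trans (cong (λ z → pow-1 ℓ * (lam * z)) (sym four-q))
              (solve 3 (λ a l q → a :* (l :* (q :+ q :+ (q :+ q))) :=
                  a :* (l :* q) :+ a :* (l :* q) :+ (a :* (l :* q) :+ a :* (l :* q))) refl (pow-1 ℓ) lam q)))
            (≤-trans (four-mono rich) (≤-reflexive (sym (pow-suc-suc ℓ _)))))

    -- `S` may contain cycles, while the optimality of `Tᵢ` speaks of rooted subtrees. A subtree of
    -- `S` with the same reachable vertices is available under a double negation, which is harmless
    -- because the goal is an instance of the decidable order.
    connected-≤-budget-max : ∀ {i Tᵢ S} (U : List Item) → IsBudgetMax χ i Tᵢ → Connected S → costS S ≤ pow i * χ →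
      (∀ v → inj₁ v ∈ U → Reach S root v) → coverV prize U ≤ prizeS Tᵢ
    connected-≤-budget-max {i} {Tᵢ} {S} U (_ , _ , best) conn cheap reach =
      decidable-stable (coverV prize U ≤? prizeS Tᵢ) λ ¬goal → spanning-subtree conn λ S′ S′⊆S sub′ reach′ →
        ¬goal (≤-trans (cover-mono inj₁ prize-nonneg (inV S′)
            (λ v v∈ → Reach-inV {S′} (inV-root S′) (reach′ v (reach v v∈))))
          (best S′ sub′ (≤-trans (costS-mono S′⊆S) cheap)))

    -- A quarter of `c + 4ℓχ ≤ 2^(i+2) χ` leaves `c / 4` for the pieces and `ℓχ` for the connectors:
    -- this is the origin of the `4ℓ` in the shift.
    quarter-cost : ∀ ℓ k i {x y c} → k ℕ.≤ ℓ → y ≤ x + ℕ→F k * χ → four x ≤ c →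
      c + ℕ→F (4 ℕ.* ℓ) * χ ≤ pow (suc (suc i)) * χ → y ≤ pow i * χ
    quarter-cost ℓ k i {x} {y} {c} k≤ℓ y≤ 4x≤c bound = four-cancel
      (≤-trans (four-mono (≤-trans y≤ (+-mono ≤-refl (*-monoʳ-≤ χ χ-nonneg (ℕ→F-mono k≤ℓ)))))
      (≤-trans (≤-reflexive (distribute (ℕ→F ℓ)))
      (≤-trans (+-mono 4x≤c (≤-reflexive (cong (_* χ) (sym (ℕ→F-* 4 ℓ)))))
      (≤-trans bound (≤-reflexive (pow-suc-suc i χ))))))
      where
      distribute : ∀ l → four (x + l * χ) ≡ four x + ℕ→F 4 * l * χ
      distribute l = solve 3 (λ x l k → x :+ l :* k :+ (x :+ l :* k) :+ (x :+ l :* k :+ (x :+ l :* k))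
        := x :+ x :+ (x :+ x) :+ (con 1 :+ (con 1 :+ (con 1 :+ (con 1 :+ con 0)))) :* l :* k) refl x l χ

    -- ℓ pieces of a tree of cost at most 4 (2^i − ℓ) χ can be connected to the
    -- root within the budget of phase i.
    budget-max-dominates : ∀ ℓ i {T Tᵢ} → RootedSubtree T → IsBudgetMax χ i Tᵢ →
      costS T + ℕ→F (4 ℕ.* ℓ) * χ ≤ pow (suc (suc i)) * χ →
      pow-1 ℓ * prizeS T ≤ pow (suc (suc ℓ)) * prizeS Tᵢ
    budget-max-dominates ℓ i {T} {Tᵢ} sub max bound = by-cost (costS T ≤? (pow i * χ))
      where
      connect : ∀ ts → ConnectedUnion ts → length ts ℕ.≤ ℓ → four (coverE cost (concatMap items ts)) ≤ costS T →
                coverV prize (concatMap items ts) ≤ prizeS Tᵢ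
      connect ts (S , conn , cost≤ , reach) len cheap =
        connected-≤-budget-max {i} {Tᵢ} {S} (concatMap items ts) max conn
          (quarter-cost ℓ (length ts) i len cost≤ cheap bound) reach
      use : QuarterPieces ℓ T → pow-1 ℓ * prizeS T ≤ pow (suc (suc ℓ)) * prizeS Tᵢ
      use (ts , vts , len , cheap , rich) = ≤-trans rich
        (*-monoˡ-≤ (pow (suc (suc ℓ))) (ℕ→F-nonneg (2 ^ suc (suc ℓ)))
          (connect ts (connected-union ts vts) len cheap))
      by-cost : Dec (costS T ≤ pow i * χ) → pow-1 ℓ * prizeS T ≤ pow (suc (suc ℓ)) * prizeS Tᵢ
      -- Here `T` itself competes in phase `i`. The other case then has positive cost, as the
      -- quotient `P / C` requires.
      by-cost (yes small) = pow-1≤4pow ℓ (prizeS-nonneg T) (proj₂ (proj₂ max) T sub small)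
      by-cost (no  large) = use (quarter-pieces ℓ {T} (proj₁ sub)
        (λ C≤0 → large (≤-trans C≤0 (*-nonneg (ℕ→F-nonneg (2 ^ i)) χ-nonneg))))

    module _ (ℓ : ℕ) (1≤ℓ : 1 ℕ.≤ ℓ) {B : Carrier} {T : ESet}
             (sub : RootedSubtree T) (c≤B : costS T ≤ B) where

      private
        D K : Carrier
        D = B + ℕ→F (4 ℕ.* ℓ ∸ 1) * χ
        K = B + ℕ→F (4 ℕ.* ℓ) * χ

      D+χ≡K : D + χ ≡ K
      D+χ≡K = trans (solve 3 (λ b a x → b :+ a :* x :+ x := b :+ (con 1 :+ a) :* x) refl B (ℕ→F (4 ℕ.* ℓ ∸ 1)) χ)
        -- `1 ≤ ℓ` makes the truncated subtraction exact.
        (cong (λ k → B + ℕ→F k * χ) (ℕP.m+[n∸m]≡n {1} (ℕP.≤-trans 1≤ℓ (ℕP.m≤m+n ℓ _))))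

      Dominated : List Edge → Set
      Dominated out = pow-1 ℓ * prizeS T ≤ pow (suc (suc ℓ)) * prizeS (Alg D out)

      Dominated-prefix : ∀ {π out} → (∃[ ρ ] out ≡ π ++ ρ) → walkCost π + χ ≤ K →
        pow-1 ℓ * prizeS T ≤ pow (suc (suc ℓ)) * prizeS (toSet π) → Dominated out
      Dominated-prefix {π} (ρ , refl) fit dom = ≤-trans dom
        (*-monoˡ-≤ (pow (suc (suc ℓ))) (ℕ→F-nonneg (2 ^ suc (suc ℓ)))
          (Alg-prefix π ρ (+-cancelʳ-≤ χ (subst (walkCost π + χ ≤_) (sym D+χ≡K) fit))))

      -- The first bound says that the phases before `i` cost at most `(2^i - 1)χ`. Adding phase
      -- `i`, of cost at most `2^i χ`, the second one puts its end within `K - χ`, which is the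
      -- budget `D`.
      dominated : ∀ {i π out} → CS χ i π out → walkCost π + χ ≤ pow i * χ → pow (suc i) * χ ≤ K → Dominated out
      -- All positive prizes are collected within the budget, so `T` is matched outright.
      dominated {i} {π} (stop spans) paid room = Dominated-prefix {π} (CS-extends {χ} {i} (stop spans))
        (≤-trans paid (≤-trans pow≤pow-suc room))
        (pow-1≤4pow ℓ (prizeS-nonneg T) (prizeS-mono-positive {T} {toSet π} λ v _ pv≰0 →
          spans v (≰⇒≥ pv≰0 , ≰0⇒≢0 pv≰0 ∘ sym)))
        where
        0≤pow : 0# ≤ pow i * χ
        0≤pow = *-nonneg (ℕ→F-nonneg (2 ^ i)) χ-nonneg
        pow≤pow-suc : pow i * χ ≤ pow (suc i) * χ
        pow≤pow-suc = ≤-trans (x≤x+y 0≤pow) (≤-reflexive (trans (sym (distribʳ χ _ _)) (cong (_* χ) (sym (pow-suc i)))))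
      dominated {i} {π} {out} (step {πᵢ = πᵢ} {π' = π′} _ Tᵢ max greedy merge rest) paid room =
        next-phase ((pow (suc (suc i)) * χ) ≤? K)
        where
        paid′ : walkCost π′ + χ ≤ pow (suc i) * χ
        paid′ = ≤-trans (+-mono (Merge-cost merge) ≤-refl)
          (≤-trans (≤-reflexive (solve 3 (λ a b c → a :+ b :+ c := a :+ c :+ b) refl (walkCost π) (walkCost πᵢ) χ))
          (≤-trans (+-mono paid (≤-trans (greedy-cost greedy) (proj₁ (proj₂ max))))
            (≤-reflexive (trans (sym (distribʳ χ _ _)) (cong (_* χ) (sym (pow-suc i)))))))
        next-phase : Dec (pow (suc (suc i)) * χ ≤ K) → Dominated out
        next-phase (yes room′) = dominated rest paid′ room′
        -- Phase `i` is the last one sure to fit. Now `K ≤ 2^(i+2) χ`, so `c(T) + 4ℓχ` is at most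
        -- four times the budget for which `Tᵢ` is optimal.
        next-phase (no ¬room′) = Dominated-prefix {π′} {out} (CS-extends rest) (≤-trans paid′ room)
          (≤-trans (budget-max-dominates ℓ i sub max (≤-trans (+-mono c≤B ≤-refl) (≰⇒≥ ¬room′)))
            (*-monoˡ-≤ (pow (suc (suc ℓ))) (ℕ→F-nonneg (2 ^ suc (suc ℓ))) (phase-prize {π = π} greedy merge)))

theorem6 : (F : OrderedField) → let open Theory F in
    (ℓ : ℕ.ℕ) → 1 ℕ.≤ ℓ → {n m : ℕ.ℕ} → (I : Instance n m) → let open Inst I in
    (χ : Carrier) → IsEccentricity χ →
    (π : List Edge) → CapacityScalingOutput χ π →
    (B : Carrier) → 0# ≤ B →
    (T : ESet) → RootedSubtree T → costS T ≤ B →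
    prizeS T ≤ (ℕ→F (2 ℕ.^ (ℓ ℕ.+ 2)) * (ℕ→F (2 ℕ.^ ℓ ℕ.∸ 1)) ⁻¹)
                 * prizeS (Alg (B + ℕ→F (4 ℕ.* ℓ ℕ.∸ 1) * χ) π)
theorem6 F ℓ 1≤ℓ {n} {m} I χ ecc π out B 0≤B T sub c≤B = *-cancelˡ-≤ M M≰0 (≤-trans final (≤-reflexive eq))
  where
  open OrderedField F
  open OrderedFieldProperties F
  open Theory.Inst F I using (prizeS; Alg; walkCost)
  open Pieces F (Theory.Instance.src I) (Theory.Instance.tgt I) using (pow; pow-1)
  open Competitive F I
  M N A : Carrier
  M = pow-1 ℓ
  N = ℕ→F (2 ^ (ℓ ℕ.+ 2))
  A = prizeS (Alg (B + ℕ→F (4 ℕ.* ℓ ∸ 1) * χ) π)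
  M≰0 : ¬ M ≤ 0#
  M≰0 M≤0 = ℕ→F-suc≰0 0 (≤-trans (ℕ→F-mono (ℕP.∸-monoˡ-≤ 1 (ℕP.^-monoʳ-≤ 2 1≤ℓ))) M≤0)
  0≤χ : 0# ≤ χ
  0≤χ = χ-nonneg ecc
  -- Phase `0` has to fit before anything can be compared: `2χ ≤ 4ℓχ` by `1 ≤ ℓ`.
  room : pow 1 * χ ≤ B + ℕ→F (4 ℕ.* ℓ) * χ
  room = ≤-trans (*-monoʳ-≤ χ 0≤χ (ℕ→F-mono
    (ℕP.≤-trans (s≤s (s≤s z≤n)) (ℕP.*-monoʳ-≤ 4 1≤ℓ)))) (y≤x+y 0≤B)
  paid : walkCost [] + χ ≤ pow 0 * χ
  paid = ≤-reflexive (solve 1 (λ x → con 0 :+ x := (con 1 :+ con 0) :* x) refl χ)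
  final : M * prizeS T ≤ N * A
  final = subst (λ k → M * prizeS T ≤ ℕ→F (2 ^ k) * A) (ℕP.+-comm 2 ℓ)
    (dominated ecc ℓ 1≤ℓ {B} {T} sub c≤B out paid room)
  eq : N * A ≡ M * (N * M ⁻¹ * A)
  eq = sym (trans (solve 4 (λ M N M⁻¹ A → M :* (N :* M⁻¹ :* A) := M :* M⁻¹ :* (N :* A)) refl M N (M ⁻¹) A)
    (trans (cong (_* (N * A)) (⁻¹-inverse M (≰0⇒≢0 M≰0))) (*-identityˡ (N * A))))
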